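{- Let $n,k$ be integers with $n\geq k\geq 4$. Then $$\operatorname{gr}_k(P_5:P_n)=\begin{cases} n+1, & \text{if } 2(k-1)\leq n\leq 4(k-2)+1,\\ \left\lceil\frac{3n-3}{2}\right\rceil, & \text{if } n>4(k-2)+1.\end{cases}$$
   Context: $P_n$ denotes the path on $n$ vertices. For graphs $G,H$ and a positive integer $k$, the Gallai-Ramsey number $\operatorname{gr}_k(G:H)$ is the minimum integer $N$ such that for every $n'\geq N$, every exact $k$-edge-coloring of the complete graph $K_{n'}$ (an edge-coloring in which exactly $k$ colors are used) contains either a rainbow copy of $G$ (a copy all of whose edges have pairwise distinct colors) or a monochromatic copy of $H$ (a copy all of whose edges have the same color). Copies are subgraphs, not necessarily induced; edge-colorings are not required to be proper. -}

module Defs where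

open import Data.Fin using (Fin; toℕ)
open import Data.Nat using (ℕ; suc; _≤_)
open import Data.Nat.Properties using (1+n≢n)
open import Data.Product using (_×_; ∃-syntax; Σ-syntax)
open import Data.Sum using (_⊎_; inj₁; inj₂; swap)
open import Function.Definitions using (Injective)
open import Level using (0ℓ)
open import Relation.Binary.Core using (Rel)
open import Relation.Binary.Definitions using (Symmetric; Irreflexive)
open import Relation.Binary.PropositionalEquality using (_≡_; _≢_; refl; ≢-sym)

record Graph : Set₁ where
  field
    order      : ℕ
    Adj        : Rel (Fin order) 0ℓ
    adj-sym    : Symmetric Adj
    adj-irrefl : Irreflexive _≡_ Adj

open Graph public

K : ℕ → Graph
K n = record
  { order      = n
  ; Adj        = _≢_
  ; adj-sym    = ≢-sym
  ; adj-irrefl = λ u≡v u≢v → u≢v u≡v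
  }

-- The index counts vertices, not edges.
P : ℕ → Graph
P n = record
  { order      = n
  ; Adj        = λ u v → suc (toℕ u) ≡ toℕ v ⊎ suc (toℕ v) ≡ toℕ u
  ; adj-sym    = swap
  ; adj-irrefl = λ { refl (inj₁ p) → 1+n≢n p ; refl (inj₂ p) → 1+n≢n p }
  }

-- `colour-undirected` quantifies over both adjacency proofs, so besides being
-- symmetric the colour does not depend on the proof of adjacency.
record EdgeColouring (F : Graph) (k : ℕ) : Set where
  field
    colour            : ∀ {u v} → Adj F u v → Fin k
    colour-undirected : ∀ {u v} (e : Adj F u v) (e′ : Adj F v u) →
                        colour e ≡ colour e′

open EdgeColouring public

Exact : ∀ {F k} → EdgeColouring F k → Set
Exact {F} {k} χ = ∀ (c : Fin k) → ∃[ u ] ∃[ v ] Σ[ e ∈ Adj F u v ] colour χ e ≡ c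

-- A copy of G in F, as a not necessarily induced subgraph.
record Copy (G F : Graph) : Set where
  field
    vertex    : Fin (order G) → Fin (order F)
    injective : Injective _≡_ _≡_ vertex
    edge      : ∀ {u v} → Adj G u v → Adj F (vertex u) (vertex v)

open Copy public

-- An edge is an unordered pair, so (u , v) and (v , u) count as the same edge.
Rainbow : ∀ {G F k} → EdgeColouring F k → Copy G F → Set
Rainbow {G} χ φ =
  ∀ {u v x y} (e : Adj G u v) (e′ : Adj G x y) →
  colour χ (edge φ e) ≡ colour χ (edge φ e′) →
  (u ≡ x × v ≡ y) ⊎ (u ≡ y × v ≡ x)

Monochromatic : ∀ {G F k} → EdgeColouring F k → Copy G F → Set
Monochromatic {G} χ φ =
  ∀ {u v x y} (e : Adj G u v) (e′ : Adj G x y) →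
  colour χ (edge φ e) ≡ colour χ (edge φ e′)

GallaiRamseyBound : ℕ → Graph → Graph → ℕ → Set
GallaiRamseyBound k G H N =
  ∀ n′ → N ≤ n′ → (χ : EdgeColouring (K n′) k) → Exact χ →
  (Σ[ φ ∈ Copy G (K n′) ] Rainbow χ φ) ⊎ (Σ[ φ ∈ Copy H (K n′) ] Monochromatic χ φ)

-- The relation gr_k(G : H) = N, rather than a function, since a minimum over ℕ
-- need not be computable; N is unique by antisymmetry of ≤.
IsGallaiRamseyNumber : ℕ → Graph → Graph → ℕ → Set
IsGallaiRamseyNumber k G H N =
  GallaiRamseyBound k G H N × (∀ M → GallaiRamseyBound k G H M → N ≤ M)

{-# OPTIONS --safe #-}
module Submission where

-- Upper bound: following Thomason and Wagner, a colouring with at least four colours and no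
-- rainbow P₅ either has a colour c such that all edges avoiding one vertex and not inside a certain
-- triple have colour c, or a dominant colour d such that all edges at any given vertex that are not
-- coloured d share one colour.  If some vertex sees three colours, the first case holds, because it
-- is forced on any six vertices; if every vertex sees at most two, these pairs of colours intersect
-- pairwise and have a common element d.  In the first case a monochromatic path misses only one
-- vertex.  In the second case, let y be missed by a path in colour d that y cannot extend.  Then the
-- ends of the path and one of any two consecutive vertices of it lie on edges of one colour s ≢ d,
-- the colour from y to the path.  One edge in each of the k - 2 other colours supplies 2(k - 2)
-- vertices of the path lying on no edge of colour s, so the path has at least 4(k - 2) + 1 vertices.
-- For larger n, contrasting d with all other colours reduces the claim to the Gerencsér–Gyárfás
-- bound on the Ramsey number of a path, since a path avoiding d is monochromatic.
--
-- Lower bounds: K_{n-1} in one colour plus a vertex sending out the others; and a K_{n-1} in one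
-- colour together with ⌊n/2⌋ - 1 vertices, where every other edge has the dominant colour except a
-- matching on the latter vertices that carries the remaining k - 2 colours.

open import Defs
open import Data.Nat using (ℕ; _+_; _*_; _∸_; _≤_; _<_; _≥_; _>_; ⌈_/2⌉)
open import Data.Product using (_×_)

import Algebra.Solver.CommutativeMonoid as CommutativeMonoidSolver
open import Data.Bool using (Bool; true; false; if_then_else_; T)
open import Data.Bool.ListAction using (all)
open import Data.Empty using (⊥; ⊥-elim)
open import Data.Fin as Fin using (Fin; toℕ; zero; suc)
open import Data.Fin.Patterns
import Data.Fin.Properties as Fin
open import Data.List using (List; []; _∷_; [_]; _++_; map; concatMap; filter; length; lookup; allFin; upTo; take)
open import Data.List.Membership.DecPropositional using () renaming (_∈?_ to mem?)
open import Data.List.Membership.Propositional using (_∈_; _∉_)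
open import Data.List.Membership.Propositional.Properties using (∈-allFin; ∈-∃++; ∈-map⁻; ∈-++⁻; ∈-++⁺ʳ; ∈-filter⁺; ∈-upTo⁺; ∈-lookup)
open import Data.List.Properties using (++-identityʳ; length-++; length-tabulate; length-take; map-∘; map-cong; filter-accept; filter-reject)
open import Data.List.Relation.Binary.Permutation.Propositional using (_↭_; ↭-refl; ↭-sym; ↭-trans; ↭⇒↭ₛ; prep; swap)
open import Data.List.Relation.Binary.Permutation.Propositional.Properties using (map⁺; ∈-resp-↭; ↭-length; shift; ++⁺ˡ; ++⁺ʳ; ++-comm; ++-commutativeMonoid)
import Data.List.Relation.Binary.Permutation.Setoid.Properties as ↭ₛ
open import Data.List.Relation.Unary.All as All using (All; []; _∷_)
import Data.List.Relation.Unary.All.Properties as All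
open import Data.List.Relation.Unary.AllPairs as AllPairs using ([]; _∷_)
open import Data.List.Relation.Unary.Any as Any using (Any; here; there)
open import Data.List.Relation.Unary.Linked using (Linked; []; [-]; _∷_)
import Data.List.Relation.Unary.Unique.DecPropositional as DecUnique
open import Data.List.Relation.Unary.Unique.Propositional using (Unique)
import Data.List.Relation.Unary.Unique.Propositional.Properties as Unique
open import Data.Maybe as Maybe using (Maybe; just; nothing)
open import Data.Nat using (zero; suc; z≤n; s≤s; s≤s⁻¹; ⌊_/2⌋; _<?_)
open import Data.Nat.DivMod using (_/_; _mod_)
import Data.Nat.Properties as ℕ
open import Data.Product as Product using (_,_; proj₁; proj₂; ∃; ∃-syntax; Σ-syntax)
open import Data.Product.Properties using (≡-dec)
open import Data.Sum as Sum using (_⊎_; inj₁; inj₂; [_,_]′)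
open import Data.Vec as Vec using (Vec; []; _∷_)
import Data.Vec.Properties as Vec
open import Function using (_∘_; id; case_of_)
open import Relation.Binary.PropositionalEquality using (_≡_; _≢_; refl; sym; trans; cong; cong₂; subst; ≢-sym; setoid)
open import Relation.Nullary using (¬_; Dec; yes; no; does; contradiction)
open import Relation.Nullary.Decidable using (True; toWitness; from-yes; map′; _×-dec_; _⊎-dec_; ¬?; decidable-stable)

private variable
  A     : Set
  x y   : A
  xs ys : List A
  m     : ℕ

-- Duplicate-free lists, permutations and complements.

Unique-resp-↭ : xs ↭ ys → Unique xs → Unique ys
Unique-resp-↭ p = ↭ₛ.Unique-resp-↭ (setoid _) (↭⇒↭ₛ p)

Unique-++ˡ : ∀ xs → Unique (xs ++ ys) → Unique xs
Unique-++ˡ []       u        = []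
Unique-++ˡ (x ∷ xs) (x∉ ∷ u) = All.++⁻ˡ xs x∉ ∷ Unique-++ˡ xs u

∈⇒↭ : x ∈ ys → ∃[ zs ] ys ↭ x ∷ zs
∈⇒↭ x∈ with ps , qs , refl ← ∈-∃++ x∈ = ps ++ qs , shift _ ps qs

-- Supplies the vertices off a path as a list `zs`; lengths and distinctness carry over along the
-- permutation.
complete : Unique xs → All (_∈ ys) xs → ∃[ zs ] xs ++ zs ↭ ys
complete {ys = ys} [] [] = ys , ↭-refl
complete {xs = x ∷ xs} {ys = ys} (x∉ ∷ u) (x∈ ∷ xs⊆)
  with ws , ys↭ ← ∈⇒↭ x∈
  with zs , p ← complete u (All.zipWith (λ (x≢ , ∈ys) → Any.tail (x≢ ∘ sym) (∈-resp-↭ ys↭ ∈ys)) (x∉ , xs⊆))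
  = zs , ↭-trans (prep x p) (↭-sym ys↭)

Unique-⊆-length : Unique xs → All (_∈ ys) xs → length xs ≤ length ys
Unique-⊆-length {xs = xs} u xs⊆ with zs , p ← complete u xs⊆ =
  subst (length xs ≤_) (trans (sym (length-++ xs)) (↭-length p)) (ℕ.m≤m+n _ _)

complete-Fin : (xs : List (Fin m)) → Unique xs → ∃[ zs ] xs ++ zs ↭ allFin m
complete-Fin xs u = complete u (All.universal ∈-allFin xs)

length-complement : ∀ (xs : List (Fin m)) {zs} → xs ++ zs ↭ allFin m → length xs + length zs ≡ m
length-complement {m = m} xs p = trans (sym (length-++ xs)) (trans (↭-length p) (length-tabulate id))

any-Vec? : {P : Vec (Fin m) x → Set} → (∀ v → Dec (P v)) → Dec (∃ P)
any-Vec? {x = zero}  P? = map′ ([] ,_) (λ { ([] , p) → p }) (P? [])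
any-Vec? {x = suc _} P? =
  map′ (λ (a , v , p) → a ∷ v , p) (λ { (a ∷ v , p) → a , v , p })
       (Fin.any? λ a → any-Vec? λ v → P? (a ∷ v))

-- Exhaustive search on six vertices

Var : Set
Var = ℕ

-- A clause (s , r) forbids the labels s together with the labels of the variables r from being distinct.
Clause : Set
Clause = List ℕ × List Var

remove : Var → List Var → Maybe (List Var)
remove v []       = nothing
remove v (w ∷ ws) with v ℕ.≟ w
... | yes _ = just ws
... | no  _ = Maybe.map (w ∷_) (remove v ws)

-- `nothing` signals a violated clause.
assign : Var → ℕ → List Clause → Maybe (List Clause)
assign v l [] = just []
assign v l ((s , r) ∷ cs) with remove v r
... | nothing = Maybe.map ((s , r) ∷_) (assign v l cs)
... | just r′ with Any.any? (l ℕ.≟_) s | r′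
-- A repeated label satisfies the clause for good, so it is dropped. With no repetition and nothing
-- left to assign, the clause is violated.
...   | yes _ | _     = assign v l cs
...   | no  _ | []    = nothing
...   | no  _ | _ ∷ _ = Maybe.map ((l ∷ s , r′) ∷_) (assign v l cs)

-- Depth-first search for a labelling of the listed edges that violates no clause; `true` means that
-- every branch closes. Clauses are simplified along a branch, so violations are found early.
refute : List (Var × List ℕ) → List Clause → Bool
close  : List (Var × List ℕ) → Maybe (List Clause) → Bool
refute []             cs = false
refute ((v , ls) ∷ D) cs = all (λ l → close D (assign v l cs)) ls
close D nothing   = true
close D (just cs) = refute D cs

module _ (g : Var → ℕ) where

  -- The invariant `Unique s` makes a clause with no variables left contradictory, which is what a
  -- closed branch needs.
  Holds : Clause → Set
  Holds (s , r) = Unique s × ¬ Unique (s ++ map g r)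

  AllHold : Maybe (List Clause) → Set
  AllHold nothing   = ⊥
  AllHold (just cs) = All Holds cs

  AllHold-∷ : ∀ {c} cs → Holds c → AllHold cs → AllHold (Maybe.map (c ∷_) cs)
  AllHold-∷ (just _) h hs = h ∷ hs

  remove-↭ : ∀ v r {r′} → remove v r ≡ just r′ → r ↭ v ∷ r′
  remove-↭ v (w ∷ r) eq with v ℕ.≟ w
  remove-↭ v (w ∷ r) refl | yes refl = ↭-refl
  ... | no _ with remove v r in eq′
  remove-↭ v (w ∷ r) refl | no _ | just r″ = ↭-trans (prep w (remove-↭ v r eq′)) (swap w v ↭-refl)

  Holds-assign : ∀ v {s r r′} → r ↭ v ∷ r′ → ¬ Any (g v ≡_) s → Holds (s , r) → Holds (g v ∷ s , r′)
  Holds-assign v {s} {r} {r′} p gv∉ (u , ¬u) =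
    All.¬Any⇒All¬ s gv∉ ∷ u ,
    ¬u ∘ Unique-resp-↭ (↭-sym (↭-trans (++⁺ˡ s (map⁺ g p)) (shift (g v) s (map g r′))))

  assign-sound : ∀ v cs → All Holds cs → AllHold (assign v (g v) cs)
  assign-sound v [] [] = []
  assign-sound v ((s , r) ∷ cs) (h ∷ hs) with remove v r in eq
  ... | nothing = AllHold-∷ (assign v (g v) cs) h (assign-sound v cs hs)
  ... | just r′ with Any.any? (g v ℕ.≟_) s | r′
  ...   | yes _  | _     = assign-sound v cs hs
  ...   | no gv∉ | _ ∷ _ = AllHold-∷ (assign v (g v) cs) (Holds-assign v (remove-↭ v r eq) gv∉ h) (assign-sound v cs hs)
  ...   | no gv∉ | []    =
    let u , ¬u = Holds-assign v (remove-↭ v r eq) gv∉ h in ¬u (subst Unique (sym (++-identityʳ _)) u)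

  -- The actual labelling `g` singles out one branch of the search. All clauses stay true along it,
  -- so it cannot close.
  refute-sound : ∀ D cs → T (refute D cs) → All (λ (v , ls) → g v ∈ ls) D → All Holds cs → ⊥
  close-sound  : ∀ D cs → T (close D cs) → All (λ (v , ls) → g v ∈ ls) D → AllHold cs → ⊥
  refute-sound ((v , ls) ∷ D) cs t (gv∈ ∷ gD) hs =
    close-sound D _ (All.lookup (All.all⁺ _ ls t) gv∈) gD (assign-sound v cs hs)
  close-sound D (just cs) = refute-sound D cs

-- Encoding of small patterns and of colour constraints.

picks : List A → List (A × List A)
picks []       = []
picks (x ∷ xs) = (x , xs) ∷ map (Product.map₂ (x ∷_)) (picks xs)

arrangements : ∀ m → List A → List (Vec A m)
arrangements zero    xs = [ [] ]
arrangements (suc m) xs = concatMap (λ (x , ys) → map (x ∷_) (arrangements m ys)) (picks xs)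

picks-↭ : ∀ (xs : List A) → All (λ (y , ys) → y ∷ ys ↭ xs) (picks xs)
picks-↭ []       = []
picks-↭ (x ∷ xs) = ↭-refl ∷ All.map⁺ (All.map (λ p → ↭-trans (swap _ _ ↭-refl) (prep x p)) (picks-↭ xs))

arrangements-↭ : ∀ m (xs : List A) → All (λ v → ∃[ zs ] Vec.toList v ++ zs ↭ xs) (arrangements m xs)
arrangements-↭ zero    xs = (xs , ↭-refl) ∷ []
arrangements-↭ (suc m) xs =
  All.concat⁺ (All.map⁺ (All.map
    (λ {(y , ys)} p → All.map⁺ (All.map (λ (zs , q) → zs , ↭-trans (prep y q) p) (arrangements-↭ m ys)))
    (picks-↭ xs)))

arrangements-Unique : ∀ m {xs : List A} → Unique xs → All (Unique ∘ Vec.toList) (arrangements m xs)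
arrangements-Unique m u =
  All.map (λ {v} (zs , p) → Unique-++ˡ (Vec.toList v) (Unique-resp-↭ (↭-sym p) u)) (arrangements-↭ m _)

Shape : ℕ → Set
Shape m = List (Fin m × Fin m)

path₅ star₄ : Shape 5
path₅ = (0F , 1F) ∷ (1F , 2F) ∷ (2F , 3F) ∷ (3F , 4F) ∷ []
star₄ = (0F , 1F) ∷ (0F , 2F) ∷ (0F , 3F) ∷ (0F , 4F) ∷ []

star₃ : Shape 4
star₃ = (0F , 1F) ∷ (0F , 2F) ∷ (0F , 3F) ∷ []

-- Both orders of an edge must give the same variable, so the smaller index becomes the leading
-- digit in base six.
code : Fin 6 → Fin 6 → Var
code i j = if does (i Fin.<? j) then toℕ i * 6 + toℕ j else toℕ j * 6 + toℕ i

-- Each copy of a shape is listed once: o lists pairs of vertices required to be increasing.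
Pattern : Set
Pattern = Shape 5 × Shape 5

P₅ K₁₄ : Pattern
P₅  = path₅ , (0F , 4F) ∷ []
K₁₄ = star₄ , (1F , 2F) ∷ (2F , 3F) ∷ (3F , 4F) ∷ []

increasing? : ∀ (o : Shape 5) (v : Vec (Fin 6) 5) → Dec (All (λ (i , j) → Vec.lookup v i Fin.< Vec.lookup v j) o)
increasing? o v = All.all? (λ (i , j) → Vec.lookup v i Fin.<? Vec.lookup v j) o

clauses : Pattern → List Clause
clauses (S , o) =
  map (λ v → [] , map (λ (i , j) → code (Vec.lookup v i) (Vec.lookup v j)) S)
      (filter (increasing? o) (arrangements 5 (allFin 6)))

data Fact (m : ℕ) : Set where
  _─_is_ _─_isn't_ : Fin 6 → Fin 6 → Fin m → Fact m

codeOf : Fact m → Var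
codeOf (i ─ j is _)    = code i j
codeOf (i ─ j isn't _) = code i j

-- Labels 0 … m - 1 name the given colours and m stands for every other colour.
labels : ∀ m → List ℕ
labels m = upTo (suc m)

allowed : Fact m → List ℕ
allowed     (_ ─ _ is c)    = [ toℕ c ]
allowed {m} (_ ─ _ isn't c) = filter (λ l → ¬? (l ℕ.≟ toℕ c)) (labels m)

edges₆ : List Var
edges₆ = concatMap (λ i → map (code i) (filter (i Fin.<?_) (allFin 6))) (allFin 6)

-- Pitfall: of several facts about one edge, only the first takes effect.
domain : List (Fact m) → List (Var × List ℕ)
domain {m} fs =
  map (λ f → codeOf f , allowed f) fs ++
  map (_, labels m) (filter (λ e → ¬? (Any.any? (e ℕ.≟_) (map codeOf fs))) edges₆)

contradictory : List Pattern → List (Fact m) → Bool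
contradictory Ss fs = refute (domain fs) (concatMap clauses Ss)

decode : Var → Fin 6 × Fin 6
decode n = (n / 6) mod 6 , n mod 6

decode-code : ∀ i j → decode (code i j) ≡ (i , j) ⊎ decode (code i j) ≡ (j , i)
decode-code = from-yes (Fin.all? λ i → Fin.all? λ j → (decode (code i j) ≟² (i , j)) ⊎-dec (decode (code i j) ≟² (j , i)))
  where _≟²_ = ≡-dec Fin._≟_ Fin._≟_

lookup-∈-toList : ∀ (v : Vec A m) i → Vec.lookup v i ∈ Vec.toList v
lookup-∈-toList (_ ∷ v) zero    = here refl
lookup-∈-toList (_ ∷ v) (suc i) = there (lookup-∈-toList v i)

lookup-injective : ∀ (v : Vec A m) → Unique (Vec.toList v) → ∀ i j → Vec.lookup v i ≡ Vec.lookup v j → i ≡ j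
lookup-injective (_ ∷ v) _        zero    zero    _  = refl
lookup-injective (_ ∷ v) (x∉ ∷ _) zero    (suc j) eq = contradiction eq (All.lookup x∉ (lookup-∈-toList v j))
lookup-injective (_ ∷ v) (x∉ ∷ _) (suc i) zero    eq = contradiction (sym eq) (All.lookup x∉ (lookup-∈-toList v i))
lookup-injective (_ ∷ v) (_ ∷ u)  (suc i) (suc j) eq = cong suc (lookup-injective v u i j eq)

-- From colourings to labellings of six vertices.

module _ {k : ℕ} where

  label : Vec (Fin k) m → Fin k → ℕ
  label []       c = 0
  label (d ∷ ds) c with c Fin.≟ d
  ... | yes _ = 0
  ... | no  _ = suc (label ds c)

  label-lookup : ∀ (ds : Vec (Fin k) m) → Unique (Vec.toList ds) → ∀ i → label ds (Vec.lookup ds i) ≡ toℕ i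
  label-lookup (d ∷ ds) (d∉ ∷ u) zero with d Fin.≟ d
  ... | yes _  = refl
  ... | no d≢d = contradiction refl d≢d
  label-lookup (d ∷ ds) (d∉ ∷ u) (suc i) with Vec.lookup ds i Fin.≟ d
  ... | yes eq = contradiction (sym eq) (All.lookup d∉ (lookup-∈-toList ds i))
  ... | no  _  = cong suc (label-lookup ds u i)

  label-injective : ∀ (ds : Vec (Fin k) m) {c} i → label ds c ≡ toℕ i → c ≡ Vec.lookup ds i
  label-injective (d ∷ ds) {c} i eq with c Fin.≟ d
  label-injective (d ∷ ds) zero    _  | yes c≡d = c≡d
  label-injective (d ∷ ds) (suc i) eq | no _    = label-injective ds i (ℕ.suc-injective eq)

  label≤ : ∀ (ds : Vec (Fin k) m) c → label ds c ≤ m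
  label≤ []       c = z≤n
  label≤ (d ∷ ds) c with c Fin.≟ d
  ... | yes _ = z≤n
  ... | no  _ = s≤s (label≤ ds c)

module Coloured {N k : ℕ} (col : Fin N → Fin N → Fin k) (col-sym : ∀ u v → col u v ≡ col v u) where

  colours : Shape m → Vec (Fin N) m → List (Fin k)
  colours S v = map (λ (i , j) → col (Vec.lookup v i) (Vec.lookup v j)) S

  Avoids : Shape m → Set
  Avoids S = ∀ v → Unique (Vec.toList v) → ¬ Unique (colours S v)

  avoids? : (S : Shape m) → (∃[ v ] Unique (Vec.toList v) × Unique (colours S v)) ⊎ Avoids S
  avoids? S with any-Vec? (λ v → DecUnique.unique? Fin._≟_ (Vec.toList v) ×-dec DecUnique.unique? Fin._≟_ (colours S v))
  ... | yes found = inj₁ found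
  ... | no  none  = inj₂ λ v u u′ → none (v , u , u′)

  module Local (vs : Vec (Fin N) 6) (vs! : Unique (Vec.toList vs))
               (cs : Vec (Fin k) m) (cs! : Unique (Vec.toList cs)) where

    colour₆ : Fin 6 → Fin 6 → Fin k
    colour₆ i j = col (Vec.lookup vs i) (Vec.lookup vs j)

    ⟦_⟧ : Fact m → Set
    ⟦ i ─ j is c ⟧    = colour₆ i j ≡ Vec.lookup cs c
    ⟦ i ─ j isn't c ⟧ = colour₆ i j ≢ Vec.lookup cs c

    g : Var → ℕ
    g n = let i , j = decode n in label cs (colour₆ i j)

    g-code : ∀ i j → g (code i j) ≡ label cs (colour₆ i j)
    g-code i j with decode-code i j
    ... | inj₁ eq = cong (λ (i , j) → label cs (colour₆ i j)) eq
    ... | inj₂ eq = trans (cong (λ (i , j) → label cs (colour₆ i j)) eq) (cong (label cs) (col-sym _ _))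

    g-labels : ∀ n → g n ∈ labels m
    g-labels n = ∈-upTo⁺ (s≤s (label≤ cs _))

    g-allowed : ∀ f → ⟦ f ⟧ → g (codeOf f) ∈ allowed f
    g-allowed (i ─ j is c) eq = here (trans (g-code i j) (trans (cong (label cs) eq) (label-lookup cs cs! c)))
    g-allowed (i ─ j isn't c) neq = ∈-filter⁺ (λ l → ¬? (l ℕ.≟ toℕ c)) (g-labels (code i j))
      (λ eq → neq (label-injective cs c (trans (sym (g-code i j)) eq)))

    g-domain : ∀ fs → All ⟦_⟧ fs → All (λ (v , ls) → g v ∈ ls) (domain fs)
    g-domain fs ps = All.++⁺ (All.map⁺ (All.map (λ {f} → g-allowed f) ps)) (All.map⁺ (All.universal g-labels _))

    Unique-map-Vec : ∀ (v : Vec (Fin 6) x) → Unique (Vec.toList v) → Unique (Vec.toList (Vec.map (Vec.lookup vs) v))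
    Unique-map-Vec v u = subst Unique (sym (Vec.toList-map _ v)) (Unique.map⁺ (λ {i} {j} → lookup-injective vs vs! i j) u)

    g-colours : ∀ S (v : Vec (Fin 6) x) →
      map g (map (λ (i , j) → code (Vec.lookup v i) (Vec.lookup v j)) S) ≡
      map (label cs) (colours S (Vec.map (Vec.lookup vs) v))
    g-colours S v = trans (sym (map-∘ S)) (trans (map-cong same S) (map-∘ S))
      where
      same : ∀ ((i , j) : Fin _ × Fin _) → _
      same (i , j) = trans (g-code _ _)
        (cong (label cs) (cong₂ col (sym (Vec.lookup-map i _ v)) (sym (Vec.lookup-map j _ v))))

    -- Distinct labels come from distinct colours. Giving all unnamed colours one label can only
    -- create repetitions, so the clauses remain true.
    g-clauses : ∀ p → Avoids (proj₁ p) → All (Holds g) (clauses p)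
    g-clauses (S , o) av = All.map⁺ (All.filter⁺ (increasing? o) (All.map holds (arrangements-Unique 5 (Unique.allFin⁺ 6))))
      where
      holds : ∀ {v} → Unique (Vec.toList v) → Holds g ([] , map (λ (i , j) → code (Vec.lookup v i) (Vec.lookup v j)) S)
      holds {v} u = [] , λ u′ →
        av (Vec.map (Vec.lookup vs) v) (Unique-map-Vec v u) (Unique.map⁻ (subst Unique (g-colours S v) u′))

    -- The implicit `T` argument is filled in as soon as the search evaluates to `true`; the case
    -- analysis is thus carried out by the type checker.
    contradiction₆ : ∀ ps → All (Avoids ∘ proj₁) ps → ∀ {fs} → All ⟦_⟧ fs → {T (contradictory ps fs)} → ⊥
    contradiction₆ ps avs {fs} facts {t} =
      refute-sound g (domain fs) (concatMap clauses ps) t (g-domain fs facts)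
        (All.concat⁺ (All.map⁺ (All.map (λ {p} → g-clauses p) avs)))

    -- The search refutes the added fact that the edge has another colour.
    forced : ∀ ps → All (Avoids ∘ proj₁) ps → ∀ {fs} → All ⟦_⟧ fs → ∀ i j c → {T (contradictory ps (fs ++ [ i ─ j isn't c ]))} → ⟦ i ─ j is c ⟧
    forced ps avs facts i j c {t} with colour₆ i j Fin.≟ Vec.lookup cs c
    ... | yes eq  = eq
    ... | no  neq = ⊥-elim (contradiction₆ ps avs (All.++⁺ facts (neq ∷ [])) {t})

select : (v : Vec A m) → Unique (Vec.toList v) → (js : List (Fin m)) → {True (DecUnique.unique? Fin._≟_ js)} →
         Unique (map (Vec.lookup v) js)
select v u js {u′} = Unique.map⁺ (λ {i} {j} → lookup-injective v u i j) (toWitness u′)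

∉-select : ∀ {w : A} (v : Vec A m) → w ∉ Vec.toList v → (js : List (Fin m)) → w ∉ map (Vec.lookup v) js
∉-select v w∉ js w∈ with ∈-map⁻ (Vec.lookup v) {xs = js} w∈
... | n , _ , refl = w∉ (lookup-∈-toList v n)

append : ∀ {A : Set} (xs : List A) {x} → Unique xs → x ∉ xs → Unique (xs ++ [ x ])
append xs {x} u x∉ = Unique-resp-↭ (++-comm [ x ] xs) (All.¬Any⇒All¬ xs x∉ ∷ u)

∉-append : ∀ {A : Set} {y x : A} xs → y ∉ xs → y ≢ x → y ∉ xs ++ [ x ]
∉-append xs y∉ y≢ y∈ with ∈-++⁻ xs y∈
... | inj₁ ∈xs       = y∉ ∈xs
... | inj₂ (here eq) = y≢ eq

fresh : (xs : List (Fin m)) → length xs < m → ∃[ w ] w ∉ xs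
fresh {m = m} xs lt with Fin.any? (λ w → ¬? (mem? Fin._≟_ w xs))
... | yes found = found
... | no  none  = contradiction lt (ℕ.≤⇒≯ (subst (_≤ length xs) (length-tabulate id)
  (Unique-⊆-length (Unique.allFin⁺ m) (All.universal (λ w → decidable-stable (mem? Fin._≟_ w xs) (λ w∉ → none (w , w∉))) _))))

-- Colourings without a rainbow P₅

module Structure {N k : ℕ} (col : Fin N → Fin N → Fin k) (col-sym : ∀ u v → col u v ≡ col v u)
                 (N≥7 : 7 ≤ N) (no-P₅ : Coloured.Avoids col col-sym path₅) where
  open Coloured col col-sym

  private
    V = Fin N
    C = Fin k

  -- Edges at the apex and edges inside {p, q, r} are unconstrained.
  record NearlyMonochromatic : Set where
    field
      apex p q r : V
      c          : C
      distinct   : Unique (apex ∷ p ∷ q ∷ r ∷ [])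
    exceptional : List V
    exceptional = apex ∷ p ∷ q ∷ r ∷ []
    field
      rim  : ∀ w → w ∉ exceptional → col p w ≡ c × col q w ≡ c × col r w ≡ c
      bulk : ∀ w u → w ∉ exceptional → u ∉ exceptional → w ≢ u → col w u ≡ c

  -- Turns a computation on six vertices into a global statement: `step` passes the rim condition
  -- from one outside vertex to any other and fixes the edge between them, so a single `w₀` is
  -- enough to start.
  spread : ∀ {v x y z} c → Unique (v ∷ x ∷ y ∷ z ∷ []) →
    let Q = v ∷ x ∷ y ∷ z ∷ []
        Rim = λ w → col x w ≡ c × col y w ≡ c × col z w ≡ c in
    (∀ w u → w ∉ Q → u ∉ Q → u ≢ w → Rim w → Rim u × col w u ≡ c) →
    ∀ w₀ → w₀ ∉ Q → Rim w₀ → NearlyMonochromatic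
  spread {v} {x} {y} {z} c Q! step w₀ w₀∉ rim₀ = record
    { apex = v ; p = x ; q = y ; r = z ; c = c ; distinct = Q! ; rim = rim
    ; bulk = λ w u w∉ u∉ w≢u → proj₂ (step w u w∉ u∉ (w≢u ∘ sym) (rim w w∉)) }
    where
    rim : ∀ w → w ∉ _ → col x w ≡ c × col y w ≡ c × col z w ≡ c
    rim w w∉ with w Fin.≟ w₀
    ... | yes refl = rim₀
    ... | no  w≢w₀ = proj₁ (step w₀ w w₀∉ w∉ w≢w₀ rim₀)

  -- The three spokes and `c` are four different colours. This lets the search on `v`, `x`, `y`,
  -- `z`, `w` and a further vertex `u` force every edge at `u` except the one to the apex.
  colourful-spokes : ∀ {v x y z} c → Unique (v ∷ x ∷ y ∷ z ∷ []) →
    Unique (col v x ∷ col v y ∷ col v z ∷ c ∷ []) →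
    ∀ w → w ∉ v ∷ x ∷ y ∷ z ∷ [] → col x w ≡ c → col y w ≡ c → col z w ≡ c → NearlyMonochromatic
  colourful-spokes {v} {x} {y} {z} c Q! cs! w₀ w₀∉ xw yw zw = spread c Q! step w₀ w₀∉ (xw , yw , zw)
    where
    step : ∀ w u → w ∉ _ → u ∉ _ → u ≢ w → _ → _
    step w u w∉ u∉ u≢w (xw , yw , zw) = (goal 1F 5F 3F , goal 2F 5F 3F , goal 3F 5F 3F) , goal 4F 5F 3F
      where
      open Local (v ∷ x ∷ y ∷ z ∷ w ∷ u ∷ []) (append (v ∷ x ∷ y ∷ z ∷ w ∷ []) (append (v ∷ x ∷ y ∷ z ∷ []) Q! w∉) (∉-append _ u∉ u≢w)) (_ ∷ _ ∷ _ ∷ c ∷ []) cs!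
      goal = forced (P₅ ∷ []) (no-P₅ ∷ [])
        {0F ─ 1F is 0F ∷ 0F ─ 2F is 1F ∷ 0F ─ 3F is 2F ∷ 1F ─ 4F is 3F ∷ 2F ─ 4F is 3F ∷ 3F ─ 4F is 3F ∷ []}
        (refl ∷ refl ∷ refl ∷ xw ∷ yw ∷ zw ∷ [])

  -- The colour of the edge from `a` to a sixth vertex `w` becomes the main colour. Whether it is
  -- new or repeats a spoke, three spokes of other colours remain for `colourful-spokes`.
  four-colours-at-vertex : ∀ v → Unique (Vec.toList v) → Unique (colours star₄ v) → NearlyMonochromatic
  four-colours-at-vertex vs@(v ∷ a ∷ b ∷ d ∷ e ∷ []) vs! cs!
    with w , w∉ ← fresh (Vec.toList vs) (ℕ.≤-trans (ℕ.m≤n+m 6 1) N≥7)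
    = result
    where
    repeats-first : col a w ≡ col v a → NearlyMonochromatic
    repeats-first aw = colourful-spokes (col v a) Q! (select cs cs! (1F ∷ 2F ∷ 3F ∷ 0F ∷ [])) w (∉-select vs w∉ (0F ∷ 2F ∷ 3F ∷ 4F ∷ []))
      (goal 2F 5F 0F) (goal 3F 5F 0F) (goal 4F 5F 0F)
      where
      cs = col v a ∷ col v b ∷ col v d ∷ col v e ∷ []
      Q! = select vs vs! (0F ∷ 2F ∷ 3F ∷ 4F ∷ [])
      open Local (v ∷ a ∷ b ∷ d ∷ e ∷ w ∷ []) (append (Vec.toList vs) vs! w∉) cs cs!
      goal = forced (P₅ ∷ []) (no-P₅ ∷ [])
        {0F ─ 1F is 0F ∷ 0F ─ 2F is 1F ∷ 0F ─ 3F is 2F ∷ 0F ─ 4F is 3F ∷ 1F ─ 5F is 0F ∷ []}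
        (refl ∷ refl ∷ refl ∷ refl ∷ aw ∷ [])

    new-colour : col a w ∉ colours star₄ vs → NearlyMonochromatic
    new-colour aw∉ = colourful-spokes (col a w) Q! (select cs cs+! (0F ∷ 1F ∷ 2F ∷ 4F ∷ [])) w (∉-select vs w∉ (0F ∷ 1F ∷ 2F ∷ 3F ∷ []))
      refl (goal 2F 5F 4F) (goal 3F 5F 4F)
      where
      cs = col v a ∷ col v b ∷ col v d ∷ col v e ∷ col a w ∷ []
      cs+! = append (colours star₄ vs) cs! aw∉
      Q! = select vs vs! (0F ∷ 1F ∷ 2F ∷ 3F ∷ [])
      open Local (v ∷ a ∷ b ∷ d ∷ e ∷ w ∷ []) (append (Vec.toList vs) vs! w∉) cs cs+!
      goal = forced (P₅ ∷ []) (no-P₅ ∷ [])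
        {0F ─ 1F is 0F ∷ 0F ─ 2F is 1F ∷ 0F ─ 3F is 2F ∷ 0F ─ 4F is 3F ∷ 1F ─ 5F is 4F ∷ []}
        (refl ∷ refl ∷ refl ∷ refl ∷ refl ∷ [])

    repeats-other : ∀ b d e → Unique (v ∷ a ∷ b ∷ d ∷ e ∷ []) → w ∉ v ∷ a ∷ b ∷ d ∷ e ∷ [] →
      Unique (col v a ∷ col v b ∷ col v d ∷ col v e ∷ []) → col a w ≡ col v b → NearlyMonochromatic
    repeats-other b d e us! w∉ cs! aw =
      colourful-spokes (col v b) (select (v ∷ a ∷ b ∷ d ∷ e ∷ []) us! (0F ∷ 1F ∷ 3F ∷ 4F ∷ [])) (select cs cs! (0F ∷ 2F ∷ 3F ∷ 1F ∷ [])) w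
        (∉-select (v ∷ a ∷ b ∷ d ∷ e ∷ []) w∉ (0F ∷ 1F ∷ 3F ∷ 4F ∷ [])) aw (goal 3F 5F 1F) (goal 4F 5F 1F)
      where
      cs = col v a ∷ col v b ∷ col v d ∷ col v e ∷ []
      open Local (v ∷ a ∷ b ∷ d ∷ e ∷ w ∷ []) (append (v ∷ a ∷ b ∷ d ∷ e ∷ []) us! w∉) cs cs!
      goal = forced (P₅ ∷ []) (no-P₅ ∷ [])
        {0F ─ 1F is 0F ∷ 0F ─ 2F is 1F ∷ 0F ─ 3F is 2F ∷ 0F ─ 4F is 3F ∷ 1F ─ 5F is 1F ∷ []}
        (refl ∷ refl ∷ refl ∷ refl ∷ aw ∷ [])

    cs = col v a ∷ col v b ∷ col v d ∷ col v e ∷ []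

    result : NearlyMonochromatic
    result with mem? Fin._≟_ (col a w) (colours star₄ vs)
    ... | yes (here eq)                         = repeats-first eq
    ... | yes (there (here eq))                 = repeats-other b d e vs! w∉ cs! eq
    ... | yes (there (there (here eq)))         =
      repeats-other d b e (select vs vs! (0F ∷ 1F ∷ 3F ∷ 2F ∷ 4F ∷ [])) (∉-select vs w∉ (0F ∷ 1F ∷ 3F ∷ 2F ∷ 4F ∷ []))
        (select cs cs! (0F ∷ 2F ∷ 1F ∷ 3F ∷ [])) eq
    ... | yes (there (there (there (here eq)))) =
      repeats-other e b d (select vs vs! (0F ∷ 1F ∷ 4F ∷ 2F ∷ 3F ∷ []))
        (∉-select vs w∉ (0F ∷ 1F ∷ 4F ∷ 2F ∷ 3F ∷ []))
        (select cs cs! (0F ∷ 3F ∷ 1F ∷ 2F ∷ [])) eq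
    ... | no  new                               = new-colour new

-- Local configurations around a vertex that sees three colours.

module ThreeColoursAtVertex {N k : ℕ} (col : Fin N → Fin N → Fin k) (col-sym : ∀ u v → col u v ≡ col v u)
  (N≥7 : 7 ≤ N) (no-P₅ : Coloured.Avoids col col-sym path₅) (no-K₁₄ : Coloured.Avoids col col-sym star₄) where
  open Coloured col col-sym
  open Structure col col-sym N≥7 no-P₅

  private
    V = Fin N
    C = Fin k

    patterns : List Pattern
    patterns = P₅ ∷ K₁₄ ∷ []

    avoided : All (Avoids ∘ proj₁) patterns
    avoided = no-P₅ ∷ no-K₁₄ ∷ []

  module _ {v x y z : V} (Q! : Unique (v ∷ x ∷ y ∷ z ∷ []))
           (cs! : Unique (col v x ∷ col v y ∷ col v z ∷ col x y ∷ [])) where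

    private
      cs : Vec C 4
      cs = col v x ∷ col v y ∷ col v z ∷ col x y ∷ []

    -- Here the main colour already occurs on the spoke to `z`, so `colourful-spokes` cannot be
    -- used; the fourth colour, on the edge from `x` to `y`, replaces it in the search.
    triangle-and-pendant : ∀ w → w ∉ v ∷ x ∷ y ∷ z ∷ [] →
      col x w ≡ col v z → col y w ≡ col v z → col z w ≡ col v z → NearlyMonochromatic
    triangle-and-pendant w₀ w₀∉ xw yw zw = spread (col v z) Q! step w₀ w₀∉ (xw , yw , zw)
      where
      step : ∀ w u → w ∉ _ → u ∉ _ → u ≢ w → _ → _
      step w u w∉ u∉ u≢w (xw , yw , zw) = (goal 1F 5F 2F , goal 2F 5F 2F , goal 3F 5F 2F) , goal 4F 5F 2F
        where
        open Local (v ∷ x ∷ y ∷ z ∷ w ∷ u ∷ [])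
          (append (v ∷ x ∷ y ∷ z ∷ w ∷ []) (append (v ∷ x ∷ y ∷ z ∷ []) Q! w∉) (∉-append _ u∉ u≢w)) cs cs!
        goal = forced patterns avoided
          {0F ─ 1F is 0F ∷ 0F ─ 2F is 1F ∷ 0F ─ 3F is 2F ∷ 1F ─ 2F is 3F ∷ 1F ─ 4F is 2F ∷ 2F ─ 4F is 2F ∷ 3F ─ 4F is 2F ∷ []}
          (refl ∷ refl ∷ refl ∷ refl ∷ xw ∷ yw ∷ zw ∷ [])

    module _ {w u : V} (w∉ : w ∉ v ∷ x ∷ y ∷ z ∷ []) (u∉ : u ∉ v ∷ x ∷ y ∷ z ∷ w ∷ []) where

      open Local (v ∷ x ∷ y ∷ z ∷ w ∷ u ∷ [])
        (append (v ∷ x ∷ y ∷ z ∷ w ∷ []) (append (v ∷ x ∷ y ∷ z ∷ []) Q! w∉) u∉) cs cs!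

      chord-of-base-colour : col x z ≡ col x y → NearlyMonochromatic
      chord-of-base-colour xz = colourful-spokes (col x y) Q! cs! w w∉ (goal 1F 4F 3F) (goal 2F 4F 3F) (goal 3F 4F 3F)
        where
        goal = forced patterns avoided
          {0F ─ 1F is 0F ∷ 0F ─ 2F is 1F ∷ 0F ─ 3F is 2F ∷ 1F ─ 2F is 3F ∷ 1F ─ 3F is 3F ∷ []}
          (refl ∷ refl ∷ refl ∷ refl ∷ xz ∷ [])

      module _ (xz≢ : col x z ≢ col x y) (yz≢ : col y z ≢ col x y) where

        private
          goal = forced patterns avoided
            {0F ─ 1F is 0F ∷ 0F ─ 2F is 1F ∷ 0F ─ 3F is 2F ∷ 1F ─ 2F is 3F ∷ 1F ─ 3F isn't 3F ∷ 2F ─ 3F isn't 3F ∷ []}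
            (refl ∷ refl ∷ refl ∷ refl ∷ xz≢ ∷ yz≢ ∷ [])

        apex-to-outside : col v w ≡ col v z
        apex-to-outside = goal 0F 4F 2F

        pendant-to-outside : col z w ≡ col v z
        pendant-to-outside = goal 3F 4F 2F

        -- The apex moves to `x`: its spokes to `v`, `y` and `z` turn out to have the colours of the
        -- edges vx, xy and vy, and `w` is joined to these three vertices in the colour of vz.
        other-apex : col x w ≢ col v z → NearlyMonochromatic
        other-apex xw≢ = colourful-spokes (col v z) (select (v ∷ x ∷ y ∷ z ∷ []) Q! (1F ∷ 0F ∷ 2F ∷ 3F ∷ []))
          (subst (λ ds → Unique (ds ++ [ col v z ])) (cong₂ (λ c d → c ∷ col x y ∷ d ∷ []) (col-sym v x) (sym xz))
            (select cs cs! (0F ∷ 3F ∷ 1F ∷ 2F ∷ [])))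
          w (∉-select (v ∷ x ∷ y ∷ z ∷ []) w∉ (1F ∷ 0F ∷ 2F ∷ 3F ∷ []))
          apex-to-outside yw pendant-to-outside
          where
          yw : col y w ≡ col v z
          yw = forced patterns avoided
            {0F ─ 1F is 0F ∷ 0F ─ 2F is 1F ∷ 0F ─ 3F is 2F ∷ 1F ─ 2F is 3F ∷ 1F ─ 3F isn't 3F ∷ 2F ─ 3F isn't 3F ∷ 1F ─ 4F isn't 2F ∷ []}
            (refl ∷ refl ∷ refl ∷ refl ∷ xz≢ ∷ yz≢ ∷ xw≢ ∷ []) 2F 4F 2F
          xz : col x z ≡ col v y
          xz = forced patterns avoided
            {0F ─ 1F is 0F ∷ 0F ─ 2F is 1F ∷ 0F ─ 3F is 2F ∷ 1F ─ 2F is 3F ∷ 0F ─ 4F is 2F ∷ 2F ─ 4F is 2F ∷ 3F ─ 4F is 2F ∷ 1F ─ 4F isn't 2F ∷ []}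
            (refl ∷ refl ∷ refl ∷ refl ∷ apex-to-outside ∷ yw ∷ pendant-to-outside ∷ xw≢ ∷ []) 1F 3F 1F

  -- If xz or yz repeats the colour of xy, that colour is the main one. Otherwise it is the colour
  -- of vz, and the apex is `v`, `x` or `y` according to the edges from `x` and `y` to `w`. Cases
  -- differing by the exchange of `x` and `y` share one proof.
  rainbow-triangle : ∀ {v x y z} → Unique (v ∷ x ∷ y ∷ z ∷ []) →
    Unique (col v x ∷ col v y ∷ col v z ∷ col x y ∷ []) → NearlyMonochromatic
  rainbow-triangle {v} {x} {y} {z} Q! cs!
    with w , w∉ ← fresh (v ∷ x ∷ y ∷ z ∷ []) (ℕ.≤-trans (ℕ.m≤n+m 5 2) N≥7)
    with u , u∉ ← fresh (v ∷ x ∷ y ∷ z ∷ w ∷ []) (ℕ.≤-trans (ℕ.m≤n+m 6 1) N≥7)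
    with col x z Fin.≟ col x y | col y z Fin.≟ col x y | col x w Fin.≟ col v z | col y w Fin.≟ col v z
  ... | yes xz | _      | _      | _      = chord-of-base-colour Q! cs! w∉ u∉ xz
  ... | no _   | yes yz | _      | _      = chord-of-base-colour Q!′ cs!′ w∉′ u∉′ (trans yz (col-sym x y))
    where
    Q!′ = select (v ∷ x ∷ y ∷ z ∷ []) Q! (0F ∷ 2F ∷ 1F ∷ 3F ∷ [])
    cs!′ = subst (λ c → Unique (col v y ∷ col v x ∷ col v z ∷ c ∷ [])) (col-sym x y)
      (select (col v x ∷ col v y ∷ col v z ∷ col x y ∷ []) cs! (1F ∷ 0F ∷ 2F ∷ 3F ∷ []))
    w∉′ = ∉-select (v ∷ x ∷ y ∷ z ∷ []) w∉ (0F ∷ 2F ∷ 1F ∷ 3F ∷ [])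
    u∉′ = ∉-select (v ∷ x ∷ y ∷ z ∷ w ∷ []) u∉ (0F ∷ 2F ∷ 1F ∷ 3F ∷ 4F ∷ [])
  ... | no xz≢ | no yz≢ | no xw≢ | _      = other-apex Q! cs! w∉ u∉ xz≢ yz≢ xw≢
  ... | no xz≢ | no yz≢ | yes xw | yes yw = triangle-and-pendant Q! cs! w w∉ xw yw (pendant-to-outside Q! cs! w∉ u∉ xz≢ yz≢)
  ... | no xz≢ | no yz≢ | yes _  | no yw≢ =
    other-apex Q!′ cs!′ w∉′ u∉′ (λ eq → yz≢ (trans eq (col-sym y x))) (λ eq → xz≢ (trans eq (col-sym y x))) yw≢
    where
    Q!′ = select (v ∷ x ∷ y ∷ z ∷ []) Q! (0F ∷ 2F ∷ 1F ∷ 3F ∷ [])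
    cs!′ = subst (λ c → Unique (col v y ∷ col v x ∷ col v z ∷ c ∷ [])) (col-sym x y)
      (select (col v x ∷ col v y ∷ col v z ∷ col x y ∷ []) cs! (1F ∷ 0F ∷ 2F ∷ 3F ∷ []))
    w∉′ = ∉-select (v ∷ x ∷ y ∷ z ∷ []) w∉ (0F ∷ 2F ∷ 1F ∷ 3F ∷ [])
    u∉′ = ∉-select (v ∷ x ∷ y ∷ z ∷ w ∷ []) u∉ (0F ∷ 2F ∷ 1F ∷ 3F ∷ 4F ∷ [])

  -- The colour of xy is the main colour and `y` serves as the first outside vertex: its edges to
  -- `b` and `d` are forced. The vertex `w` completes the six vertices of the search.
  rainbow-kite : ∀ {v x y b d} → Unique (v ∷ x ∷ y ∷ b ∷ d ∷ []) →
    Unique (col v x ∷ col v b ∷ col v d ∷ col x y ∷ []) → col v y ≡ col v x → NearlyMonochromatic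
  rainbow-kite {v} {x} {y} {b} {d} vs! cs! vy
    with w , w∉ ← fresh (v ∷ x ∷ y ∷ b ∷ d ∷ []) (ℕ.≤-trans (ℕ.m≤n+m 6 1) N≥7)
    = colourful-spokes (col x y) (select vs vs! (0F ∷ 1F ∷ 3F ∷ 4F ∷ [])) cs! y y∉ refl
        (trans (col-sym b y) (goal 2F 3F 3F)) (trans (col-sym d y) (goal 2F 4F 3F))
    where
    vs = v ∷ x ∷ y ∷ b ∷ d ∷ []
    y∉ : y ∉ v ∷ x ∷ b ∷ d ∷ []
    y∉ = Unique.Unique[x∷xs]⇒x∉xs (select vs vs! (2F ∷ 0F ∷ 1F ∷ 3F ∷ 4F ∷ []))
    open Local (v ∷ x ∷ y ∷ b ∷ d ∷ w ∷ []) (append (Vec.toList vs) vs! w∉) (_ ∷ _ ∷ _ ∷ col x y ∷ []) cs!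
    goal = forced patterns avoided
      {0F ─ 1F is 0F ∷ 0F ─ 2F is 0F ∷ 0F ─ 3F is 1F ∷ 0F ─ 4F is 2F ∷ 1F ─ 2F is 3F ∷ []}
      (refl ∷ vy ∷ refl ∷ refl ∷ refl ∷ [])

-- The dichotomy: nearly monochromatic or with a dominant colour.

module Decomposition {N k : ℕ} (col : Fin N → Fin N → Fin k) (col-sym : ∀ u v → col u v ≡ col v u)
  (N≥7 : 7 ≤ N) (k≥4 : 4 ≤ k) (exact : ∀ c → ∃[ u ] ∃[ v ] u ≢ v × col u v ≡ c) (no-P₅ : Coloured.Avoids col col-sym path₅) where
  open Coloured col col-sym
  open Structure col col-sym N≥7 no-P₅

  private
    V = Fin N
    C = Fin k

  Dominant : C → Set
  Dominant d = ∀ {u v w} → u ≢ v → v ≢ w → col u v ≢ d → col v w ≢ d → col u v ≡ col v w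

  star-Unique : ∀ {v as} → All (v ≢_) as → Unique (map (col v) as) → Unique (v ∷ as)
  star-Unique v≢ u = v≢ ∷ Unique.map⁻ u

  module _ (no-K₁₄ : Avoids star₄) where
    open ThreeColoursAtVertex col col-sym N≥7 no-P₅ no-K₁₄

    module _ {v a b d : V} (v≢ : All (v ≢_) (a ∷ b ∷ d ∷ [])) (cs! : Unique (map (col v) (a ∷ b ∷ d ∷ []))) where

      sees-three : ∀ {u} → v ≢ u → col v u ∈ map (col v) (a ∷ b ∷ d ∷ [])
      sees-three {u} v≢u with mem? Fin._≟_ (col v u) (map (col v) (a ∷ b ∷ d ∷ []))
      ... | yes ∈cs = ∈cs
      ... | no  ∉cs =
        let us! = append (map (col v) (a ∷ b ∷ d ∷ [])) cs! ∉cs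
        in ⊥-elim (no-K₁₄ (v ∷ a ∷ b ∷ d ∷ u ∷ []) (star-Unique (All.++⁺ v≢ (v≢u ∷ [])) us!) us!)

      -- Any chosen neighbour `u` of `v` can represent its own colour among the three spokes.
      exchange : ∀ {u} → v ≢ u → ∃[ e ] ∃[ f ] All (v ≢_) (u ∷ e ∷ f ∷ []) ×
        map (col v) (u ∷ e ∷ f ∷ []) ↭ map (col v) (a ∷ b ∷ d ∷ [])
      exchange {u} v≢u = go v≢ (sees-three v≢u)
        where
        go : All (v ≢_) (a ∷ b ∷ d ∷ []) → col v u ∈ map (col v) (a ∷ b ∷ d ∷ []) → _
        replacing : ∀ {c ds} → col v u ≡ c → c ∷ ds ↭ map (col v) (a ∷ b ∷ d ∷ []) →
          col v u ∷ ds ↭ map (col v) (a ∷ b ∷ d ∷ [])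
        replacing {ds = ds} eq = subst (λ c → c ∷ ds ↭ map (col v) (a ∷ b ∷ d ∷ [])) (sym eq)
        go (_ ∷ v≢b ∷ v≢d ∷ []) (here eq) =
          b , d , v≢u ∷ v≢b ∷ v≢d ∷ [] , replacing eq ↭-refl
        go (v≢a ∷ _ ∷ v≢d ∷ []) (there (here eq)) =
          a , d , v≢u ∷ v≢a ∷ v≢d ∷ [] , replacing eq (swap _ _ ↭-refl)
        go (v≢a ∷ v≢b ∷ _ ∷ []) (there (there (here eq))) =
          a , b , v≢u ∷ v≢a ∷ v≢b ∷ [] , replacing eq (++-comm [ col v d ] (col v a ∷ col v b ∷ []))

    -- The edge vy repeats one of the three spoke colours. If it is that of `x`, there is a kite;
    -- otherwise `y` replaces `b` or `d` and vxy is a rainbow triangle with a pendant edge.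
    colour-missed-by-apex : ∀ {v x b d y} → All (v ≢_) (x ∷ b ∷ d ∷ []) →
      Unique (map (col v) (x ∷ b ∷ d ∷ [])) → v ≢ y → x ≢ y → col x y ∉ map (col v) (x ∷ b ∷ d ∷ []) → NearlyMonochromatic
    colour-missed-by-apex {v} {x} {b} {d} {y} v≢@(v≢x ∷ v≢b ∷ v≢d ∷ []) cs! v≢y x≢y xy∉ with sees-three v≢ cs! v≢y
    ... | here eq = rainbow-kite (star-Unique′ cs!) (append (map (col v) (x ∷ b ∷ d ∷ [])) cs! xy∉) eq
      where
      star-Unique′ : Unique (map (col v) (x ∷ b ∷ d ∷ [])) → Unique (v ∷ x ∷ y ∷ b ∷ d ∷ [])
      star-Unique′ ((xb ∷ xd ∷ []) ∷ bd!) =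
        (v≢x ∷ v≢y ∷ v≢b ∷ v≢d ∷ []) ∷ (x≢y ∷ xb ∘ cong (col v) ∷ xd ∘ cong (col v) ∷ []) ∷
        ((λ y≡b → xb (trans (sym eq) (cong (col v) y≡b))) ∷ (λ y≡d → xd (trans (sym eq) (cong (col v) y≡d))) ∷ []) ∷
        Unique.map⁻ bd!
    ... | there (here eq) = rainbow-triangle (star-Unique (v≢x ∷ v≢y ∷ v≢d ∷ []) us!)
        (append (map (col v) (x ∷ y ∷ d ∷ [])) us! (subst (λ c → col x y ∉ col v x ∷ c ∷ col v d ∷ []) (sym eq) xy∉))
      where us! = subst (λ c → Unique (col v x ∷ c ∷ col v d ∷ [])) (sym eq) cs!
    ... | there (there (here eq)) = rainbow-triangle (star-Unique (v≢x ∷ v≢y ∷ v≢b ∷ []) us!)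
        (append (map (col v) (x ∷ y ∷ b ∷ [])) us! 
          (λ p → xy∉ (∈-resp-↭ (prep _ (swap _ _ ↭-refl)) (subst (λ c → col x y ∈ col v x ∷ c ∷ col v b ∷ []) eq p))))
      where us! = subst (λ c → Unique (col v x ∷ c ∷ col v b ∷ [])) (sym eq) (Unique-resp-↭ (prep _ (swap _ _ ↭-refl)) cs!)

    three-colours-at-vertex : ∀ vs → Unique (Vec.toList vs) → Unique (colours star₃ vs) → NearlyMonochromatic
    three-colours-at-vertex (v ∷ a ∷ b ∷ d ∷ []) (v≢ ∷ _) cs!
      -- As k ≥ 4, some colour is missing at `v`, and exactness gives an edge of that colour,
      -- necessarily away from `v`.
      with c , c∉ ← fresh (map (col v) (a ∷ b ∷ d ∷ [])) k≥4
      with x , y , x≢y , refl ← exact c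
      = conclude (exchange v≢ cs! v≢x)
      where
      v≢x : v ≢ x
      v≢x refl = c∉ (sees-three v≢ cs! x≢y)
      v≢y : v ≢ y
      v≢y refl = c∉ (subst (_∈ map (col v) (a ∷ b ∷ d ∷ [])) (col-sym v x) (sees-three v≢ cs! (x≢y ∘ sym)))
      conclude : _ → NearlyMonochromatic
      conclude (e , f , v≢′ , p) =
        colour-missed-by-apex v≢′ (Unique-resp-↭ (↭-sym p) cs!) v≢y x≢y (c∉ ∘ ∈-resp-↭ p)

  module _ (no-K₁₃ : Avoids star₃) where

    palette : ∀ {v a b u} → v ≢ a → v ≢ b → v ≢ u → col v a ≢ col v b → col v u ≡ col v a ⊎ col v u ≡ col v b
    palette {v} {a} {b} {u} v≢a v≢b v≢u a≢b with col v u Fin.≟ col v a | col v u Fin.≟ col v b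
    ... | yes eq | _      = inj₁ eq
    ... | no _   | yes eq = inj₂ eq
    ... | no u≢a | no u≢b = ⊥-elim (no-K₁₃ (v ∷ u ∷ a ∷ b ∷ []) (star-Unique (v≢u ∷ v≢a ∷ v≢b ∷ []) cs!) cs!)
      where
      cs! : Unique (col v u ∷ col v a ∷ col v b ∷ [])
      cs! = (u≢a ∷ u≢b ∷ []) ∷ (a≢b ∷ []) ∷ [] ∷ []

    Obstruction : C → Vec V 3 → Set
    Obstruction d (v ∷ a ∷ b ∷ []) = Unique (v ∷ a ∷ b ∷ []) × Unique (d ∷ col v a ∷ col v b ∷ [])

    obstruction? : ∀ d vs → Dec (Obstruction d vs)
    obstruction? d (v ∷ a ∷ b ∷ []) = DecUnique.unique? Fin._≟_ _ ×-dec DecUnique.unique? Fin._≟_ _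

    unobstructed : ∀ d → ¬ ∃ (Obstruction d) → Dominant d
    unobstructed d none {u} {v} {w} u≢v v≢w uv≢d vw≢d with col u v Fin.≟ col v w
    ... | yes eq = eq
    ... | no neq = ⊥-elim (none (v ∷ u ∷ w ∷ [] , star-Unique (u≢v ∘ sym ∷ v≢w ∷ []) us! , (d≢vu ∷ vw≢d ∘ sym ∷ []) ∷ us!))
      where
      d≢vu : d ≢ col v u
      d≢vu eq = uv≢d (trans (col-sym u v) (sym eq))
      us! : Unique (col v u ∷ col v w ∷ [])
      us! = ((λ eq → neq (trans (col-sym u v) eq)) ∷ []) ∷ [] ∷ []

    obstruction-misses : ∀ {d v a b} → Obstruction d (v ∷ a ∷ b ∷ []) → ∀ {u} → v ≢ u → col v u ≢ d
    obstruction-misses ((v≢a ∷ v≢b ∷ []) ∷ _ , (d≢a ∷ d≢b ∷ []) ∷ (a≢b ∷ []) ∷ _) v≢u vu≡d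
      with palette v≢a v≢b v≢u a≢b
    ... | inj₁ eq = d≢a (trans (sym vu≡d) eq)
    ... | inj₂ eq = d≢b (trans (sym vu≡d) eq)

    -- Each vertex of such a triangle sees only its two triangle colours, so an edge uw of a fourth
    -- colour is disjoint from it. Besides that colour `u` sees only one other, which would have to
    -- lie in the palettes of `x`, `y` and `z`; these have no common colour.
    no-rainbow-triangle : ∀ {x y z} → x ≢ y → x ≢ z → y ≢ z →
      col x y ≢ col x z → col x y ≢ col y z → col x z ≢ col y z → ⊥
    no-rainbow-triangle {x} {y} {z} x≢y x≢z y≢z xy≢xz xy≢yz xz≢yz
      with e , e∉ ← fresh (col x y ∷ col x z ∷ col y z ∷ []) k≥4
      with u , w , u≢w , refl ← exact e = clash
      where
      at-x : ∀ {u} → x ≢ u → col x u ≡ col x y ⊎ col x u ≡ col x z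
      at-x x≢u = palette x≢y x≢z x≢u xy≢xz
      at-y : ∀ {u} → y ≢ u → col y u ≡ col x y ⊎ col y u ≡ col y z
      at-y y≢u = Sum.map₁ (λ eq → trans eq (col-sym y x)) (palette (x≢y ∘ sym) y≢z y≢u (λ eq → xy≢yz (trans (col-sym x y) eq)))
      at-z : ∀ {u} → z ≢ u → col z u ≡ col x z ⊎ col z u ≡ col y z
      at-z z≢u = Sum.map (λ eq → trans eq (col-sym z x)) (λ eq → trans eq (col-sym z y))
        (palette (x≢z ∘ sym) (y≢z ∘ sym) z≢u (λ eq → xz≢yz (trans (col-sym x z) (trans eq (col-sym z y)))))
      xy∉ : col u w ≢ col x y
      xy∉ = e∉ ∘ here
      xz∉ : col u w ≢ col x z
      xz∉ = e∉ ∘ there ∘ here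
      yz∉ : col u w ≢ col y z
      yz∉ = e∉ ∘ there ∘ there ∘ here
      u≢x : u ≢ x
      u≢x refl = [ xy∉ , xz∉ ]′ (at-x u≢w)
      u≢y : u ≢ y
      u≢y refl = [ xy∉ , yz∉ ]′ (at-y u≢w)
      u≢z : u ≢ z
      u≢z refl = [ xz∉ , yz∉ ]′ (at-z u≢w)
      ux : col u x ≡ col x y ⊎ col u x ≡ col x z
      ux = Sum.map (trans (col-sym u x)) (trans (col-sym u x)) (at-x (u≢x ∘ sym))
      uy : col u y ≡ col x y ⊎ col u y ≡ col y z
      uy = Sum.map (trans (col-sym u y)) (trans (col-sym u y)) (at-y (u≢y ∘ sym))
      uz : col u z ≡ col x z ⊎ col u z ≡ col y z
      uz = Sum.map (trans (col-sym u z)) (trans (col-sym u z)) (at-z (u≢z ∘ sym))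
      same : ∀ {t} → u ≢ t → col u w ≢ col u t → col u w ≢ col u x → col u t ≡ col u x
      same u≢t t∉ x∉ with palette u≢w u≢x u≢t x∉
      ... | inj₁ eq = contradiction (sym eq) t∉
      ... | inj₂ eq = eq
      ≢via : ∀ {c d e} → col u w ≢ d → col u w ≢ e → c ≡ d ⊎ c ≡ e → col u w ≢ c
      ≢via d∉ _ (inj₁ refl) = d∉
      ≢via _ e∉ (inj₂ refl) = e∉
      y≡x : col u y ≡ col u x
      y≡x = same u≢y (≢via xy∉ yz∉ uy) (≢via xy∉ xz∉ ux)
      z≡x : col u z ≡ col u x
      z≡x = same u≢z (≢via xz∉ yz∉ uz) (≢via xy∉ xz∉ ux)
      clash : ⊥
      clash with ux | uy | uz
      ... | inj₁ p | _      | inj₁ r = xy≢xz (trans (sym p) (trans (sym z≡x) r))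
      ... | inj₁ p | _      | inj₂ r = xy≢yz (trans (sym p) (trans (sym z≡x) r))
      ... | inj₂ p | inj₁ q | _      = xy≢xz (trans (sym q) (trans y≡x p))
      ... | inj₂ p | inj₂ q | _      = xz≢yz (trans (sym p) (trans (sym y≡x) q))

    -- If every colour is obstructed, let `x` see two colours and let `y` and `z` miss one of them
    -- each. The edges from `x` to `y` and `z` are then determined, and yz can have neither colour,
    -- so xyz is rainbow.
    dominant : ∃ Dominant
    dominant with Fin.any? (λ d → ¬? (any-Vec? (obstruction? d)))
    ... | yes (d , none) = d , unobstructed d none
    ... | no  every      = ⊥-elim absurd
      where
      obstruction : ∀ d → ∃ (Obstruction d)
      obstruction d = decidable-stable (any-Vec? (obstruction? d)) (λ none → every (d , none))
      absurd : ⊥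
      absurd
        -- The colour fed to `obstruction` is arbitrary; it only serves to find a vertex with two
        -- colours.
        with x ∷ a ∷ b ∷ [] , (x≢a ∷ x≢b ∷ []) ∷ _ , _ ∷ (a≢b ∷ []) ∷ _ ← obstruction (Fin.fromℕ< k≥4)
        with y ∷ _ ∷ _ ∷ [] , y-obs ← obstruction (col x a)
        with z ∷ _ ∷ _ ∷ [] , z-obs ← obstruction (col x b) = 
        no-rainbow-triangle x≢y x≢z y≢z
          (λ eq → a≢b (trans (sym xz) (trans (sym eq) xy)))
          (λ eq → obstruction-misses z-obs (y≢z ∘ sym) (trans (col-sym z y) (trans (sym eq) xy)))
          (λ eq → obstruction-misses y-obs y≢z (trans (sym eq) xz))
        where
        x≢y : x ≢ y
        x≢y refl = obstruction-misses y-obs x≢a refl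
        x≢z : x ≢ z
        x≢z refl = obstruction-misses z-obs x≢b refl
        xy : col x y ≡ col x b
        xy with palette x≢a x≢b x≢y a≢b
        ... | inj₁ eq = contradiction (trans (col-sym y x) eq) (obstruction-misses y-obs (x≢y ∘ sym))
        ... | inj₂ eq = eq
        xz : col x z ≡ col x a
        xz with palette x≢a x≢b x≢z a≢b
        ... | inj₁ eq = eq
        ... | inj₂ eq = contradiction (trans (col-sym z x) eq) (obstruction-misses z-obs (x≢z ∘ sym))
        y≢z : y ≢ z
        y≢z refl = obstruction-misses z-obs (x≢y ∘ sym) (trans (col-sym y x) xy)

  decompose : NearlyMonochromatic ⊎ ∃ Dominant
  decompose with avoids? star₄
  ... | inj₁ (vs , vs! , cs!) = inj₁ (four-colours-at-vertex vs vs! cs!)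
  ... | inj₂ no-K₁₄ with avoids? star₃
  ...   | inj₁ (vs , vs! , cs!) = inj₁ (three-colours-at-vertex no-K₁₄ vs vs! cs!)
  ...   | inj₂ no-K₁₃           = inj₂ (dominant no-K₁₃)

-- Paths in two-coloured complete graphs

PathOn : {V : Set} → (V → V → Set) → ℕ → Set
PathOn R n = ∃[ xs ] length xs ≡ n × Unique xs × Linked R xs

data Walk {V : Set} (B : V → V → Set) : V → V → List V → Set where
  stop : ∀ a → Walk B a a [ a ]
  _∷_ : ∀ {a b z xs} → B a b → Walk B b z xs → Walk B a z (a ∷ xs)

module Walks {V : Set} (B : V → V → Set) (B-sym : ∀ {u v} → B u v → B v u) where

  infixr 5 _++⟨_⟩_

  -- Vertices are recorded up to permutation, so joining and reversing walks leaves only identities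
  -- in a commutative monoid to check.
  Joined : V → V → List V → Set
  Joined a z S = ∃[ xs ] Walk B a z xs × xs ↭ S

  _++⟨_⟩_ : ∀ {a z b w S T} → Joined a z S → B z b → Joined b w T → Joined a w (S ++ T)
  (xs , W , p) ++⟨ zb ⟩ (ys , W′ , q) = xs ++ ys , append-walk W , ↭-trans (++⁺ʳ ys p) (++⁺ˡ _ q)
    where
    append-walk : ∀ {a xs} → Walk B a _ xs → Walk B a _ (xs ++ ys)
    append-walk (stop _) = zb ∷ W′
    append-walk (r ∷ W)  = r ∷ append-walk W

  point : ∀ a → Joined a a [ a ]
  point a = [ a ] , stop a , ↭-refl

  reversed : ∀ {a z S} → Joined a z S → Joined z a S
  reversed (_ , W , p) = let ys , W′ , q = reverseWalk W in ys , W′ , ↭-trans q p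
    where
    reverseWalk : ∀ {a z xs} → Walk B a z xs → Joined z a xs
    reverseWalk (stop a) = point a
    reverseWalk {xs = a ∷ xs} (r ∷ W) =
      let ys , W′ , q = reverseWalk W ++⟨ B-sym r ⟩ point a
      in ys , W′ , ↭-trans q (++-comm xs [ a ])

  Walk⇒Linked : ∀ {a z xs} → Walk B a z xs → Linked B xs
  Walk⇒Linked (stop a)             = [-]
  Walk⇒Linked (r ∷ W@(stop _))    = r ∷ Walk⇒Linked W
  Walk⇒Linked (r ∷ W@(_ ∷ _))     = r ∷ Walk⇒Linked W

  Joined⇒PathOn : ∀ {a z S} → Unique S → Joined a z S → PathOn B (length S)
  Joined⇒PathOn u (xs , W , p) = xs , ↭-length p , Unique-resp-↭ (↭-sym p) u , Walk⇒Linked W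

module TwoColouring {V : Set} (R B : V → V → Set)
  (R-sym : ∀ {u v} → R u v → R v u) (B-sym : ∀ {u v} → B u v → B v u) (decide : ∀ u v → R u v ⊎ B u v) where

  open Walks B B-sym

  -- The constraints met by y when it cannot be inserted after x in the red path x ∷ xs.
  data Blocked (y : V) : V → List V → Set where
    end  : ∀ {x} → B y x → Blocked y x []
    step : ∀ {x x′ xs} → B y x ⊎ B y x′ → Blocked y x′ xs → Blocked y x (x′ ∷ xs)

  insert : ∀ y x xs → Linked R (x ∷ xs) → (∃[ zs ] Linked R (x ∷ zs) × x ∷ zs ↭ y ∷ x ∷ xs) ⊎ Blocked y x xs
  insert y x [] _ with decide y x
  ... | inj₁ r = inj₁ ([ y ] , R-sym r ∷ [-] , swap x y ↭-refl)
  ... | inj₂ b = inj₂ (end b)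
  insert y x (x′ ∷ xs) (r ∷ l) with insert y x′ xs l
  ... | inj₁ (zs , l′ , p) = inj₁ (x′ ∷ zs , r ∷ l′ , ↭-trans (prep x p) (swap x y ↭-refl))
  ... | inj₂ blocked with decide y x | decide y x′
  ...   | inj₁ r₁ | inj₁ r₂ = inj₁ (y ∷ x′ ∷ xs , R-sym r₁ ∷ r₂ ∷ l , swap x y ↭-refl)
  ...   | inj₂ b  | _       = inj₂ (step (inj₁ b) blocked)
  ...   | _       | inj₂ b  = inj₂ (step (inj₂ b) blocked)

  -- `insert` keeps `x` at the head of the path. Extension in front of `x` is tried separately,
  -- which accounts for the additional conclusion `B y x`.
  extend-or-block : ∀ x xs → Unique (x ∷ xs) → Linked R (x ∷ xs) → ∀ ys → All (_∉ x ∷ xs) ys →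
    PathOn R (suc (length (x ∷ xs))) ⊎ All (λ y → B y x × Blocked y x xs) ys
  extend-or-block x xs u l [] [] = inj₂ []
  extend-or-block x xs u l (y ∷ ys) (y∉ ∷ ys∉) with decide y x | insert y x xs l
  ... | inj₁ r | _ = inj₁ (y ∷ x ∷ xs , refl , All.¬Any⇒All¬ _ y∉ ∷ u , r ∷ l)
  ... | inj₂ _ | inj₁ (zs , l′ , p) =
    inj₁ (x ∷ zs , ↭-length p , Unique-resp-↭ (↭-sym p) (All.¬Any⇒All¬ _ y∉ ∷ u) , l′)
  ... | inj₂ b | inj₂ blocked = Sum.map₂ ((b , blocked) ∷_) (extend-or-block x xs u l ys ys∉)

  open CommutativeMonoidSolver (++-commutativeMonoid {A = V}) using (solve; _⊜_; _⊕_)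

  -- The blue paths constructed below use other vertices than those counted in the goal; only their
  -- number matters.
  same-length : ∀ {F} S T Z Z′ → F ↭ S ++ T ++ Z → length Z ≡ length Z′ → PathOn B (length F) → PathOn B (length (S ++ T ++ Z′))
  same-length S T Z Z′ p eq = subst (PathOn B) (trans (↭-length p) (trans (lengths Z) (trans (cong (λ n → length S + (length T + n)) eq) (sym (lengths Z′)))))
    where
    lengths : ∀ (Z : List V) → length (S ++ T ++ Z) ≡ length S + (length T + length Z)
    lengths Z = trans (length-++ S) (cong (length S +_) (length-++ T))

  module _ (x₁ : V) where

    Good : V → List V → V → Set
    Good p xs y = B y x₁ × Blocked y p xs

    neighbour : ∀ {p q xs y} → Blocked y p (q ∷ xs) → ∃[ t ] ∃[ t′ ] [ t ] ++ [ t′ ] ↭ [ p ] ++ [ q ] × B y t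
    neighbour (step (inj₁ b) _) = _ , _ , ↭-refl , b
    neighbour (step (inj₂ b) _) = _ , _ , swap _ _ ↭-refl , b

    -- By the pigeonhole principle: each of three blocked vertices is joined in blue to `p` or `q`,
    -- so two of them share one.
    common : ∀ {p q xs y₁ y₂ y₃} → Blocked y₁ p (q ∷ xs) → Blocked y₂ p (q ∷ xs) → Blocked y₃ p (q ∷ xs) →
      ∃[ t ] ∃[ t′ ] [ t ] ++ [ t′ ] ↭ [ p ] ++ [ q ] × ((B y₁ t × B y₂ t) ⊎ (B y₁ t × B y₃ t) ⊎ (B y₂ t × B y₃ t))
    common (step (inj₁ b₁) _) (step (inj₁ b₂) _) _                  = _ , _ , ↭-refl , inj₁ (b₁ , b₂)
    common (step (inj₂ b₁) _) (step (inj₂ b₂) _) _                  = _ , _ , swap _ _ ↭-refl , inj₁ (b₁ , b₂)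
    common (step (inj₁ b₁) _) (step (inj₂ b₂) _) (step (inj₁ b₃) _) = _ , _ , ↭-refl , inj₂ (inj₁ (b₁ , b₃))
    common (step (inj₁ b₁) _) (step (inj₂ b₂) _) (step (inj₂ b₃) _) = _ , _ , swap _ _ ↭-refl , inj₂ (inj₂ (b₂ , b₃))
    common (step (inj₂ b₁) _) (step (inj₁ b₂) _) (step (inj₁ b₃) _) = _ , _ , ↭-refl , inj₂ (inj₂ (b₂ , b₃))
    common (step (inj₂ b₁) _) (step (inj₁ b₂) _) (step (inj₂ b₃) _) = _ , _ , swap _ _ ↭-refl , inj₂ (inj₁ (b₁ , b₃))

    drop₂ : ∀ {p q r xs y} → Good p (q ∷ r ∷ xs) y → Good r xs y
    drop₂ (b , step _ (step _ blocked)) = b , blocked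

    -- Of y and the heads of the two blue walks, two have a common blue neighbour among the next two
    -- vertices of the red path; it links them, so that two blue walks remain.
    blue-path : ∀ p q xs ys {a a′ b b′} S T W {whole} → Unique whole → Joined a a′ S → Joined b b′ T →
      All (Good p (q ∷ xs)) (a ∷ a′ ∷ b ∷ b′ ∷ []) → All (Good p (q ∷ xs)) ys →
      length xs ≤ 1 + 2 * length ys →
      S ++ T ++ ys ++ [ p ] ++ [ q ] ++ xs ++ [ x₁ ] ++ W ↭ whole →
      PathOn B (length (S ++ T ++ [ p ] ++ [ q ] ++ xs))
    -- Every outside vertex is joined in blue to `x₁` and to the last red vertex, here `q`. The
    -- latter links the two walks and the former is put in front.
    blue-path p q [] ys S T W u JS JT ((ax , _) ∷ (_ , step _ (end a′q)) ∷ (_ , step _ (end bq)) ∷ _) _ _ perm =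
      same-length S T ([ x₁ ] ++ [ q ]) (p ∷ q ∷ [])
        (solve 4 (λ x s q t → (x ⊕ s ⊕ q ⊕ t) ⊜ (s ⊕ t ⊕ x ⊕ q)) ↭-refl [ x₁ ] S [ q ] T) refl
        (Joined⇒PathOn F! (point x₁ ++⟨ B-sym ax ⟩ JS ++⟨ a′q ⟩ point q ++⟨ B-sym bq ⟩ JT))
      where
      F = [ x₁ ] ++ S ++ [ q ] ++ T
      F! : Unique F
      F! = Unique-++ˡ F (Unique-resp-↭ (↭-sym (↭-trans (solve 7 (λ s t y p q x w →
        ((x ⊕ s ⊕ q ⊕ t) ⊕ (y ⊕ p ⊕ w)) ⊜ (s ⊕ t ⊕ y ⊕ p ⊕ q ⊕ x ⊕ w)) ↭-refl S T ys [ p ] [ q ] [ x₁ ] W) perm)) u)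
    -- Now `l` is the last red vertex and links the walks; `b′` continues to one of `p` and `q`.
    blue-path p q (l ∷ []) ys S T W u JS JT
      ((ax , _) ∷ (_ , step _ (step _ (end a′l))) ∷ (_ , step _ (step _ (end bl))) ∷ (_ , b′-blocked) ∷ _) _ _ perm
      with t , t′ , pq , b′t ← neighbour b′-blocked
      = same-length S T ([ x₁ ] ++ [ l ] ++ [ t ]) (p ∷ q ∷ l ∷ [])
        (solve 5 (λ x s l t z → (x ⊕ s ⊕ l ⊕ t ⊕ z) ⊜ (s ⊕ t ⊕ x ⊕ l ⊕ z)) ↭-refl [ x₁ ] S [ l ] T [ t ]) refl
        (Joined⇒PathOn (F! t t′ pq) (point x₁ ++⟨ B-sym ax ⟩ JS ++⟨ a′l ⟩ point l ++⟨ B-sym bl ⟩ JT ++⟨ b′t ⟩ point t))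
      where
      F! : ∀ t t′ → [ t ] ++ [ t′ ] ↭ [ p ] ++ [ q ] → Unique ([ x₁ ] ++ S ++ [ l ] ++ T ++ [ t ])
      F! t t′ pq = Unique-++ˡ ([ x₁ ] ++ S ++ [ l ] ++ T ++ [ t ]) (Unique-resp-↭ (↭-sym (↭-trans (solve 8 (λ s t y p q l x w →
        ((x ⊕ s ⊕ l ⊕ t ⊕ p) ⊕ (q ⊕ y ⊕ w)) ⊜ ((p ⊕ q) ⊕ s ⊕ t ⊕ y ⊕ l ⊕ x ⊕ w)) ↭-refl S T ys [ t ] [ t′ ] [ l ] [ x₁ ] W)
        (↭-trans (++⁺ʳ _ pq) (↭-trans (solve 8 (λ s t y p q l x w →
        ((p ⊕ q) ⊕ s ⊕ t ⊕ y ⊕ l ⊕ x ⊕ w) ⊜ (s ⊕ t ⊕ y ⊕ p ⊕ q ⊕ l ⊕ x ⊕ w)) ↭-refl S T ys [ p ] [ q ] [ l ] [ x₁ ] W) perm)))) u)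
    blue-path p q (r ∷ s ∷ xs) [] S T W u JS JT goods gys (s≤s ()) perm
    blue-path p q (r ∷ s ∷ xs) (y ∷ ys) {a} {a′} {b} {b′} S T W {whole} u JS JT (ga ∷ ga′ ∷ gb ∷ gb′ ∷ []) (gy ∷ gys) len perm
      with t , t′ , pq , shared ← common (proj₂ gy) (proj₂ ga) (proj₂ gb) = go shared
      where
      len′ : length xs ≤ 1 + 2 * length ys
      len′ = s≤s⁻¹ (s≤s⁻¹ (subst (2 + length xs ≤_) (cong suc (ℕ.*-suc 2 (length ys))) len))
      perm′ : ([ t ] ++ [ t′ ]) ++ S ++ T ++ [ y ] ++ ys ++ [ r ] ++ [ s ] ++ xs ++ [ x₁ ] ++ W ↭ whole
      perm′ = ↭-trans (++⁺ʳ _ pq) (↭-trans (solve 8 (λ S T y ys p q c w →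
        ((p ⊕ q) ⊕ S ⊕ T ⊕ y ⊕ ys ⊕ c ⊕ w) ⊜ (S ⊕ T ⊕ (y ⊕ ys) ⊕ p ⊕ q ⊕ c ⊕ w)) ↭-refl S T [ y ] ys [ p ] [ q ] (r ∷ s ∷ xs) ([ x₁ ] ++ W)) perm)
      recurse : ∀ {a a′ b b′} S′ T′ → Joined a a′ S′ → Joined b b′ T′ →
        All (Good p (q ∷ r ∷ s ∷ xs)) (a ∷ a′ ∷ b ∷ b′ ∷ []) → S′ ++ T′ ↭ S ++ T ++ [ y ] ++ [ t ] →
        PathOn B (length (S ++ T ++ p ∷ q ∷ r ∷ s ∷ xs))
      recurse S′ T′ JS′ JT′ goods moved =
        same-length S T ([ y ] ++ [ t ] ++ r ∷ s ∷ xs) (p ∷ q ∷ r ∷ s ∷ xs)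
          (↭-trans (solve 3 (λ s t c → (s ⊕ t ⊕ c) ⊜ ((s ⊕ t) ⊕ c)) ↭-refl S′ T′ (r ∷ s ∷ xs))
            (↭-trans (++⁺ʳ _ moved)
              (solve 5 (λ s t y z c → ((s ⊕ t ⊕ y ⊕ z) ⊕ c) ⊜ (s ⊕ t ⊕ y ⊕ z ⊕ c)) ↭-refl S T [ y ] [ t ] (r ∷ s ∷ xs)))) refl
          (blue-path r s xs ys S′ T′ ([ t′ ] ++ W) u JS′ JT′ (All.map drop₂ goods) (All.map drop₂ gys) len′
            (↭-trans (solve 6 (λ s t y c x w → (s ⊕ t ⊕ y ⊕ c ⊕ x ⊕ w) ⊜ ((s ⊕ t) ⊕ y ⊕ c ⊕ x ⊕ w)) ↭-refl S′ T′ ys (r ∷ s ∷ xs) [ x₁ ] ([ t′ ] ++ W))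
            (↭-trans (++⁺ʳ _ moved)
            (↭-trans (solve 9 (λ s t y ys z z′ c x w → ((s ⊕ t ⊕ y ⊕ z) ⊕ ys ⊕ c ⊕ x ⊕ (z′ ⊕ w)) ⊜ ((z ⊕ z′) ⊕ s ⊕ t ⊕ y ⊕ ys ⊕ c ⊕ x ⊕ w))
                       ↭-refl S T [ y ] ys [ t ] [ t′ ] (r ∷ s ∷ xs) [ x₁ ] W) perm′))))
      go : (B y t × B a t) ⊎ (B y t × B b t) ⊎ (B a t × B b t) → PathOn B (length (S ++ T ++ p ∷ q ∷ r ∷ s ∷ xs))
      go (inj₁ (yt , at)) =
        recurse ([ y ] ++ [ t ] ++ S) T (point y ++⟨ yt ⟩ point t ++⟨ B-sym at ⟩ JS) JT (gy ∷ ga′ ∷ gb ∷ gb′ ∷ [])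
          (solve 4 (λ s t y z → ((y ⊕ z ⊕ s) ⊕ t) ⊜ (s ⊕ t ⊕ y ⊕ z)) ↭-refl S T [ y ] [ t ])
      go (inj₂ (inj₁ (yt , bt))) =
        recurse S ([ y ] ++ [ t ] ++ T) JS (point y ++⟨ yt ⟩ point t ++⟨ B-sym bt ⟩ JT) (ga ∷ ga′ ∷ gy ∷ gb′ ∷ [])
          (solve 4 (λ s t y z → (s ⊕ y ⊕ z ⊕ t) ⊜ (s ⊕ t ⊕ y ⊕ z)) ↭-refl S T [ y ] [ t ])
      -- The two walks merge through `t`, and `y` starts a new walk of one vertex.
      go (inj₂ (inj₂ (at , bt))) =
        recurse (S ++ [ t ] ++ T) [ y ] (reversed JS ++⟨ at ⟩ point t ++⟨ B-sym bt ⟩ JT) (point y) (ga′ ∷ gb′ ∷ gy ∷ gy ∷ [])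
          (solve 4 (λ s t y z → ((s ⊕ z ⊕ t) ⊕ y) ⊜ (s ⊕ t ⊕ y ⊕ z)) ↭-refl S T [ y ] [ t ])

Unique-++-disjoint : ∀ {A : Set} (xs : List A) {ys} → Unique (xs ++ ys) → All (_∉ xs) ys
Unique-++-disjoint xs u = All.tabulate λ y∈ys y∈xs → clash xs u y∈xs y∈ys
  where
  clash : ∀ {A : Set} (xs : List A) {ys y} → Unique (xs ++ ys) → y ∈ xs → y ∈ ys → ⊥
  clash (x ∷ xs) (x∉ ∷ _) (here refl) y∈ys = All.lookup x∉ (∈-++⁺ʳ xs y∈ys) refl
  clash (x ∷ xs) (_ ∷ u)  (there p)   y∈ys = clash xs u p y∈ys

shorten : ∀ {V : Set} {R : V → V → Set} {m n} → m ≤ n → PathOn R n → PathOn R m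
shorten {R = R} {m} m≤n (xs , refl , u , l) =
  take m xs , trans (length-take m xs) (ℕ.m≤n⇒m⊓n≡m m≤n) , Unique.take⁺ m u , linked-take m l
  where
  linked-take : ∀ m {xs} → Linked R xs → Linked R (take m xs)
  linked-take zero          _       = []
  linked-take (suc m)       []      = []
  linked-take (suc zero)    [-]     = [-]
  linked-take (suc (suc m)) [-]     = [-]
  linked-take (suc zero)    (r ∷ l) = [-]
  linked-take (suc (suc m)) (r ∷ l) = r ∷ linked-take (suc m) l

-- The two-colour Ramsey bound for paths.

module Ramsey {N : ℕ} where

  -- The bound leaves at least half as many vertices off the red path as on it. If none of them can
  -- enter, they are enough for `blue-path` to build a blue path with one vertex more.
  grow : (R B : Fin N → Fin N → Set) → (∀ {u v} → R u v → R v u) → (∀ {u v} → B u v → B v u) →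
    (∀ u v → R u v ⊎ B u v) → ∀ {m} → 3 * suc m ≤ 2 * N →
    PathOn R (suc m) → PathOn R (suc (suc m)) ⊎ PathOn B (suc (suc m))
  grow R B R-sym B-sym decide 3m≤2N (x ∷ xs , refl , u , l)
    with ys , p ← complete-Fin (x ∷ xs) u
    with whole! ← Unique-resp-↭ (↭-sym p) (Unique.allFin⁺ N)
    with extend-or-block x xs u l ys (Unique-++-disjoint (x ∷ xs) whole!)
    where open TwoColouring R B R-sym B-sym decide
  ... | inj₁ longer  = inj₁ longer
  ... | inj₂ blocked = inj₂ (go xs ys whole! blocked room)
    where
    open TwoColouring R B R-sym B-sym decide
    room : suc (length xs) ≤ 2 * length ys
    room = ℕ.+-cancelˡ-≤ (2 * suc (length xs)) _ _ (begin
      2 * suc (length xs) + suc (length xs) ≡⟨ ℕ.+-comm (2 * suc (length xs)) _ ⟩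
      3 * suc (length xs)                   ≤⟨ 3m≤2N ⟩
      2 * N                                 ≡⟨ cong (2 *_) (sym (length-complement (x ∷ xs) p)) ⟩
      2 * (suc (length xs) + length ys)     ≡⟨ ℕ.*-distribˡ-+ 2 (suc (length xs)) (length ys) ⟩
      2 * suc (length xs) + 2 * length ys   ∎)
      where open ℕ.≤-Reasoning
    open CommutativeMonoidSolver (++-commutativeMonoid {A = Fin N}) using (solve; _⊜_; _⊕_)
    go : ∀ xs ys → Unique ((x ∷ xs) ++ ys) →
      All (λ y → B y x × Blocked y x xs) ys → suc (length xs) ≤ 2 * length ys → PathOn B (suc (suc (length xs)))
    go []       (y ∷ ys) whole! ((yx , _) ∷ _) room =
      y ∷ x ∷ [] , refl , Unique-resp-↭ (swap _ _ ↭-refl) (Unique-++ˡ (x ∷ y ∷ []) whole!) , yx ∷ [-]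
    go (z ∷ []) (y ∷ ys) whole! ((yx , step _ (end yz)) ∷ _) room =
      x ∷ y ∷ z ∷ [] , refl , Unique-resp-↭ (prep _ (swap _ _ ↭-refl)) (Unique-++ˡ (x ∷ z ∷ y ∷ []) whole!) , B-sym yx ∷ yz ∷ [-]
    go (v ∷ w ∷ xs) (y ∷ [])      whole! blocked (s≤s (s≤s ()))
    go (v ∷ w ∷ xs) (y₁ ∷ y₂ ∷ ys) whole! blocked room with All.map good blocked
      where
      good : ∀ {y} → B y x × Blocked y x (v ∷ w ∷ xs) → B y x × Blocked y v (w ∷ xs)
      good (yx , step _ b) = yx , b
    ... | g₁ ∷ g₂ ∷ gs =
      blue-path x v w xs ys [ y₁ ] [ y₂ ] [] whole! (point y₁) (point y₂) (g₁ ∷ g₁ ∷ g₂ ∷ g₂ ∷ []) gs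
        (s≤s⁻¹ (s≤s⁻¹ (s≤s⁻¹ (subst (3 + length xs ≤_) (trans (ℕ.*-distribˡ-+ 2 2 (length ys)) refl) room))))
        (solve 7 (λ a b ys v w xs x → (a ⊕ b ⊕ ys ⊕ v ⊕ w ⊕ xs ⊕ x) ⊜ ((x ⊕ v ⊕ w ⊕ xs) ⊕ a ⊕ b ⊕ ys)) ↭-refl
          [ y₁ ] [ y₂ ] ys [ v ] [ w ] xs [ x ])
      where open Walks B B-sym

  -- With n = m + 1 the hypothesis reads N ≥ n - 1 + ⌊n/2⌋. The induction extends whichever path is
  -- at hand, exchanging the roles of the colours if it is blue.
  ramsey : (R B : Fin N → Fin N → Set) → (∀ {u v} → R u v → R v u) → (∀ {u v} → B u v → B v u) →
    (∀ u v → R u v ⊎ B u v) → 0 < N → ∀ m → 3 * m ≤ 2 * N → PathOn R (suc m) ⊎ PathOn B (suc m)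
  ramsey R B R-sym B-sym decide 0<N zero    _  = inj₁ ([ Fin.fromℕ< 0<N ] , refl , [] ∷ [] , [-])
  ramsey R B R-sym B-sym decide 0<N (suc m) le
    with ramsey R B R-sym B-sym decide 0<N m (ℕ.≤-trans (ℕ.*-monoʳ-≤ 3 (ℕ.n≤1+n m)) le)
  ... | inj₁ red  = grow R B R-sym B-sym decide le red
  ... | inj₂ blue = Sum.swap (grow B R B-sym R-sym (λ u v → Sum.swap (decide u v)) le blue)

-- Long paths in nearly monochromatic colourings.

module MonochromaticPaths {N k : ℕ} (col : Fin N → Fin N → Fin k) (col-sym : ∀ u v → col u v ≡ col v u)
  (N≥7 : 7 ≤ N) (k≥4 : 4 ≤ k) (exact : ∀ c → ∃[ u ] ∃[ v ] u ≢ v × col u v ≡ c) (no-P₅ : Coloured.Avoids col col-sym path₅) where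
  open Structure col col-sym N≥7 no-P₅
  open Decomposition col col-sym N≥7 k≥4 exact no-P₅

  private
    V = Fin N
    C = Fin k

  Monochrome : C → V → V → Set
  Monochrome c u v = col u v ≡ c

  MonochromaticPath : ℕ → Set
  MonochromaticPath n = ∃[ c ] PathOn (Monochrome c) n

  -- The edges among `p`, `q` and `r` are unconstrained, so two outside vertices separate them. The
  -- resulting path p a q b r ... omits only the apex.
  nearly-monochromatic-path : NearlyMonochromatic → ∀ {n} → suc n ≤ N → MonochromaticPath n
  nearly-monochromatic-path nm {n} n<N with complete-Fin _ (NearlyMonochromatic.distinct nm)
  ... | ws , perm = go ws perm (ℕ.≤-trans N≥7 (ℕ.≤-reflexive (sym (length-complement exceptional perm))))
    where
    open NearlyMonochromatic nm
    open CommutativeMonoidSolver (++-commutativeMonoid {A = V}) using (solve; _⊜_; _⊕_)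
    go : ∀ ws → exceptional ++ ws ↭ allFin N → 7 ≤ 4 + length ws → MonochromaticPath n
    go []           _ (s≤s (s≤s (s≤s (s≤s ()))))
    go (_ ∷ [])     _ (s≤s (s≤s (s≤s (s≤s (s≤s ())))))
    go (a ∷ b ∷ ws) perm _ with Unique-resp-↭ (↭-sym perm) (Unique.allFin⁺ N)
    ... | whole! with Unique-++-disjoint exceptional whole!
    ... | a∉ ∷ b∉ ∷ ws∉ =
      c , shorten (s≤s⁻¹ (ℕ.≤-trans n<N (ℕ.≤-reflexive (sym (length-complement exceptional perm)))))
        ( p ∷ a ∷ q ∷ b ∷ r ∷ ws , refl
        , Unique-resp-↭ (solve 6 (λ p q r a b ws → (p ⊕ q ⊕ r ⊕ a ⊕ b ⊕ ws) ⊜ (p ⊕ a ⊕ q ⊕ b ⊕ r ⊕ ws)) ↭-refl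
            [ p ] [ q ] [ r ] [ a ] [ b ] ws) (AllPairs.tail whole!)
        , proj₁ (rim a a∉) ∷ trans (col-sym a q) (proj₁ (proj₂ (rim a a∉))) ∷ proj₁ (proj₂ (rim b b∉)) ∷
          trans (col-sym b r) (proj₂ (proj₂ (rim b b∉))) ∷
          from-r ws ws∉ (AllPairs.tail (AllPairs.tail (AllPairs.tail (AllPairs.tail (AllPairs.tail (AllPairs.tail whole!)))))))
      where
      linked : ∀ ws → All (_∉ exceptional) ws → Unique ws → Linked (Monochrome c) ws
      linked []           _                _                = []
      linked (_ ∷ [])     _                _                = [-]
      linked (v ∷ w ∷ ws) (v∉ ∷ ws∉@(w∉ ∷ _)) ((v≢w ∷ _) ∷ u) = bulk v w v∉ w∉ v≢w ∷ linked (w ∷ ws) ws∉ u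
      from-r : ∀ ws → All (_∉ exceptional) ws → Unique ws → Linked (Monochrome c) (r ∷ ws)
      from-r []       _             _ = [-]
      from-r (w ∷ ws) ws∉@(w∉ ∷ _) u = proj₂ (proj₂ (rim w w∉)) ∷ linked (w ∷ ws) ws∉ u

-- Long paths in the presence of a dominant colour.

module DominantColour {N k : ℕ} (col : Fin N → Fin N → Fin k) (col-sym : ∀ u v → col u v ≡ col v u)
  (exact : ∀ c → ∃[ u ] ∃[ v ] u ≢ v × col u v ≡ c) (d : Fin k)
  (dominant : ∀ {u v w} → u ≢ v → v ≢ w → col u v ≢ d → col v w ≢ d → col u v ≡ col v w) where

  private
    V = Fin N
    C = Fin k

  R B : V → V → Set
  R u v = col u v ≡ d
  B u v = col u v ≢ d

  R-sym : ∀ {u v} → R u v → R v u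
  R-sym {u} {v} = trans (col-sym v u)

  B-sym : ∀ {u v} → B u v → B v u
  B-sym {u} {v} b = b ∘ trans (col-sym u v)

  decide : ∀ u v → R u v ⊎ B u v
  decide u v with col u v Fin.≟ d
  ... | yes r = inj₁ r
  ... | no  b = inj₂ b

  open TwoColouring R B R-sym B-sym decide

  -- Consecutive edges share a vertex and avoid `d`, so dominance makes their colours equal.
  B-path-monochromatic : ∀ {n} → PathOn B n → ∃[ c ] PathOn (λ u v → col u v ≡ c) n
  B-path-monochromatic (xs , len , u , l) = let c , l′ = go xs u l in c , xs , len , u , l′
    where
    go : ∀ xs → Unique xs → Linked B xs → ∃[ c ] Linked (λ u v → col u v ≡ c) xs
    go []           _                                _       = d , []
    go (_ ∷ [])     _                                _       = d , [-]
    go (u ∷ v ∷ []) _                                _       = col u v , refl ∷ [-]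
    go (u ∷ v ∷ w ∷ xs) ((u≢v ∷ _) ∷ vs!@((v≢w ∷ _) ∷ _)) (uv ∷ l@(vw ∷ _)) with go (v ∷ w ∷ xs) vs! l
    ... | c , eq ∷ l′ = c , trans (dominant u≢v v≢w uv vw) eq ∷ eq ∷ l′

  Sees : V → C → Set
  Sees v c = ∃[ u ] v ≢ u × col v u ≡ c

  sees? : ∀ v c → Dec (Sees v c)
  sees? v c = Fin.any? λ u → ¬? (v Fin.≟ u) ×-dec (col v u Fin.≟ c)

  sees-unique : ∀ {v c c′} → Sees v c → Sees v c′ → c ≢ d → c′ ≢ d → c ≡ c′
  sees-unique {v} (u , v≢u , refl) (w , v≢w , refl) c≢d c′≢d =
    trans (col-sym v u) (dominant (v≢u ∘ sym) v≢w (c≢d ∘ trans (col-sym v u)) c′≢d)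

  ends : C → List V
  ends c = let u , v , _ = exact c in u ∷ v ∷ []

  ends-see : ∀ c {v} → v ∈ ends c → Sees v c
  ends-see c p with exact c | p
  ... | u , v , u≢v , eq | here refl         = v , u≢v , eq
  ... | u , v , u≢v , eq | there (here refl) = u , u≢v ∘ sym , trans (col-sym v u) eq

  concatMap-ends-see : ∀ cs {v} → v ∈ concatMap ends cs → ∃[ c ] c ∈ cs × Sees v c
  concatMap-ends-see (c ∷ cs) v∈ with ∈-++⁻ (ends c) v∈
  ... | inj₁ v∈c  = c , here refl , ends-see c v∈c
  ... | inj₂ v∈cs = let c′ , c′∈ , s = concatMap-ends-see cs v∈cs in c′ , there c′∈ , s

  -- A vertex sees at most one colour besides `d`, so edges chosen in different such colours are
  -- disjoint.
  concatMap-ends-Unique : ∀ cs → Unique cs → All (_≢ d) cs → Unique (concatMap ends cs)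
  concatMap-ends-Unique []       _        _            = []
  concatMap-ends-Unique (c ∷ cs) (c∉ ∷ u) (c≢d ∷ cs≢d) =
    Unique.++⁺ ends! (concatMap-ends-Unique cs u cs≢d) λ (v∈c , v∈cs) →
      let c′ , c′∈ , s = concatMap-ends-see cs v∈cs
      in All.lookup c∉ c′∈ (sees-unique (ends-see c v∈c) s c≢d (All.lookup cs≢d c′∈))
    where
    ends! : Unique (ends c)
    ends! = let _ , _ , u≢v , _ = exact c in (u≢v ∷ []) ∷ [] ∷ []

  length-concatMap-ends : ∀ cs → length (concatMap ends cs) ≡ 2 * length cs
  length-concatMap-ends []       = refl
  length-concatMap-ends (c ∷ cs) = trans (cong (2 +_) (length-concatMap-ends cs)) (sym (ℕ.*-suc 2 (length cs)))

  module _ (s : C) where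

    outside? : ∀ v → Dec (¬ Sees v s)
    outside? v = ¬? (sees? v s)

    outside : List V → List V
    outside = filter outside?

    -- Two consecutive vertices of a path that y cannot enter never both lie outside the class of y.
    outside-sparse : ∀ {y x xs} → (∀ {v} → y ≢ v → B y v → Sees v s) → All (y ≢_) (x ∷ xs) → Blocked y x xs →
      2 * length (outside (x ∷ xs)) ≤ length (x ∷ xs) ×
      (Sees x s → 2 * length (outside (x ∷ xs)) + 1 ≤ length (x ∷ xs))
    outside-sparse {y} {x} {xs} into y≢ blocked = by-class (sees? x s)
      where
      inside : ∀ {xs} → Sees x s → All (y ≢_) (x ∷ xs) → Blocked y x xs → 2 * length (outside (x ∷ xs)) + 1 ≤ length (x ∷ xs)
      inside {xs} xs∈ y≢ blocked =
        subst (λ l → 2 * length l + 1 ≤ length (x ∷ xs)) (sym (filter-reject outside? (λ ¬s → ¬s xs∈))) (rest y≢ blocked)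
        where
        rest : ∀ {xs} → All (y ≢_) (x ∷ xs) → Blocked y x xs → 2 * length (outside xs) + 1 ≤ length (x ∷ xs)
        rest _        (end _)    = s≤s z≤n
        rest (_ ∷ y≢) (step _ b) = ℕ.≤-trans (ℕ.≤-reflexive (ℕ.+-comm _ 1)) (s≤s (proj₁ (outside-sparse into y≢ b)))
      not-inside : ∀ {xs} → ¬ Sees x s → All (y ≢_) (x ∷ xs) → Blocked y x xs → 2 * length (outside (x ∷ xs)) ≤ length (x ∷ xs)
      not-inside x∉ (y≢x ∷ _) (end b)           = contradiction (into y≢x b) x∉
      not-inside x∉ (y≢x ∷ _) (step (inj₁ b) _) = contradiction (into y≢x b) x∉
      -- Since `x` lies outside, the blue edge goes to `x′`, which therefore sees `s`; the sharper
      -- bound from `x′` on pays for `x`.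
      not-inside {x′ ∷ xs} x∉ (_ ∷ y≢@(y≢x′ ∷ _)) (step (inj₂ b) blocked) =
        subst (λ l → 2 * length l ≤ length (x ∷ x′ ∷ xs)) (sym (filter-accept outside? x∉))
          (ℕ.≤-trans (ℕ.≤-reflexive (trans (ℕ.*-suc 2 _) (cong suc (ℕ.+-comm 1 _))))
            (s≤s (proj₂ (outside-sparse into y≢ blocked) (into y≢x′ b))))
      by-class : Dec (Sees x s) → 2 * length (outside (x ∷ xs)) ≤ length (x ∷ xs) ×
        (Sees x s → 2 * length (outside (x ∷ xs)) + 1 ≤ length (x ∷ xs))
      by-class (yes xs∈) = ℕ.≤-trans (ℕ.m≤m+n _ 1) (inside xs∈ y≢ blocked) , λ _ → inside xs∈ y≢ blocked
      by-class (no  x∉)  = not-inside x∉ y≢ blocked , λ xs∈ → contradiction xs∈ x∉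

  -- If no vertex enters, all vertices off the path see `s`, the colour from `y` to `x`. The 2(k -
  -- 2) ends of edges chosen in the colours other than `d` and `s` do not, so they lie on the path.
  -- By `outside-sparse`, sharpened because the head `x` sees `s`, the path has at least 4(k - 2) +
  -- 1 vertices.
  grow-dominant : ∀ {m} → suc m < N → suc m ≤ 4 * (k ∸ 2) → PathOn R (suc m) → PathOn R (suc (suc m))
  grow-dominant m<N m≤ (x ∷ xs , refl , u , l)
    with zs , perm ← complete-Fin (x ∷ xs) u
    with whole! ← Unique-resp-↭ (↭-sym perm) (Unique.allFin⁺ N)
    with zs∉ ← Unique-++-disjoint (x ∷ xs) whole!
    with extend-or-block x xs u l zs zs∉
  ... | inj₁ longer  = longer
  ... | inj₂ blocked = ⊥-elim (go zs perm zs∉ blocked)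
    where
    go : ∀ zs → (x ∷ xs) ++ zs ↭ allFin N → All (_∉ x ∷ xs) zs → All (λ y → B y x × Blocked y x xs) zs → ⊥
    go [] perm _ _ = ℕ.<-irrefl (trans (sym (ℕ.+-identityʳ _)) (length-complement (x ∷ xs) perm)) m<N
    go zs@(y ∷ _) perm zs∉@(y∉ ∷ _) blocked@((yx , y-blocked) ∷ _)
      with cs , cs-perm ← complete-Fin (d ∷ col y x ∷ []) ((yx ∘ sym ∷ []) ∷ [] ∷ [])
      = ℕ.<⇒≱ (ℕ.≤-trans (s≤s m≤) (ℕ.≤-reflexive (ℕ.+-comm 1 _))) (begin
        4 * (k ∸ 2) + 1                          ≡⟨ cong (λ n → 4 * n + 1) (sym cs-length) ⟩
        4 * length cs + 1                        ≡⟨ cong (_+ 1) (ℕ.*-assoc 2 2 (length cs)) ⟩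
        2 * (2 * length cs) + 1                  ≡⟨ cong (λ n → 2 * n + 1) (sym (length-concatMap-ends cs)) ⟩
        2 * length (concatMap ends cs) + 1       ≤⟨ ℕ.+-monoˡ-≤ 1 (ℕ.*-monoʳ-≤ 2 (Unique-⊆-length outer! outer⊆)) ⟩
        2 * length (outside s (x ∷ xs)) + 1      ≤⟨ proj₂ (outside-sparse s into y≢ y-blocked) (into (All.head y≢) yx) ⟩
        length (x ∷ xs)                          ∎)
      where
      open ℕ.≤-Reasoning
      s : C
      s = col y x
      y≢ : All (y ≢_) (x ∷ xs)
      y≢ = All.¬Any⇒All¬ _ y∉
      into : ∀ {v} → y ≢ v → B y v → Sees v s
      into {v} y≢v yv = y , y≢v ∘ sym , dominant (y≢v ∘ sym) (All.head y≢) (B-sym yv) yx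
      zs-see : ∀ {z} → z ∈ zs → Sees z s
      zs-see z∈ = x , z≢x , trans (dominant z≢x (All.head y≢ ∘ sym) (proj₁ (All.lookup blocked z∈)) (B-sym yx)) (col-sym x y)
        where z≢x = All.lookup zs∉ z∈ ∘ here
      cs-length : length cs ≡ k ∸ 2
      cs-length = cong (_∸ 2) (length-complement (d ∷ s ∷ []) cs-perm)
      cs! : Unique (d ∷ s ∷ cs)
      cs! = Unique-resp-↭ (↭-sym cs-perm) (Unique.allFin⁺ k)
      cs≢d : All (_≢ d) cs
      cs≢d = All.map (_∘ sym) (All.tail (AllPairs.head cs!))
      outer! : Unique (concatMap ends cs)
      outer! = concatMap-ends-Unique cs (AllPairs.tail (AllPairs.tail cs!)) cs≢d
      unseen : ∀ {v} → v ∈ concatMap ends cs → ¬ Sees v s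
      unseen v∈ s∈ = let c , c∈ , sees = concatMap-ends-see cs v∈ in
        All.lookup (AllPairs.head (AllPairs.tail cs!)) c∈ (sees-unique s∈ sees yx (All.lookup cs≢d c∈))
      outer⊆ : All (_∈ outside s (x ∷ xs)) (concatMap ends cs)
      outer⊆ = All.tabulate λ v∈ → ∈-filter⁺ (outside? s)
        ([ id , (λ v∈zs → contradiction (zs-see v∈zs) (unseen v∈)) ]′
          (∈-++⁻ (x ∷ xs) (∈-resp-↭ (↭-sym perm) (∈-allFin _)))) (unseen v∈)

  dominant-path : ∀ m → m < N → m ≤ 4 * (k ∸ 2) → PathOn R (suc m)
  dominant-path zero    0<N _  = [ Fin.fromℕ< 0<N ] , refl , [] ∷ [] , [-]
  dominant-path (suc m) m<N le =
    grow-dominant m<N le (dominant-path m (ℕ.<-trans (ℕ.n<1+n m) m<N) (ℕ.≤-trans (ℕ.n≤1+n m) le))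

-- Translation between vertex lists and copies of graphs.

module UpperBound {N k : ℕ} (N≥7 : 7 ≤ N) (k≥4 : 4 ≤ k) (χ : EdgeColouring (K N) k) (χ-exact : Exact χ) where

  colour-irrelevant : ∀ {u v} (e e′ : u ≢ v) → colour χ e ≡ colour χ e′
  colour-irrelevant e e′ = trans (colour-undirected χ e (≢-sym e)) (colour-undirected χ (≢-sym e) e′)

  -- The value on the diagonal is junk.
  col : Fin N → Fin N → Fin k
  col u v with u Fin.≟ v
  ... | yes _  = Fin.fromℕ< k≥4
  ... | no u≢v = colour χ u≢v

  col-edge : ∀ {u v} (e : u ≢ v) → col u v ≡ colour χ e
  col-edge {u} {v} e with u Fin.≟ v
  ... | yes u≡v = contradiction u≡v e
  ... | no  u≢v = colour-irrelevant u≢v e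

  col-sym : ∀ u v → col u v ≡ col v u
  col-sym u v with u Fin.≟ v
  ... | yes refl = sym (diagonal u)
    where
    diagonal : ∀ u → col u u ≡ Fin.fromℕ< k≥4
    diagonal u with u Fin.≟ u
    ... | yes _  = refl
    ... | no u≢u = contradiction refl u≢u
  ... | no u≢v = trans (colour-undirected χ u≢v (≢-sym u≢v)) (sym (col-edge (≢-sym u≢v)))

  exact : ∀ c → ∃[ u ] ∃[ v ] u ≢ v × col u v ≡ c
  exact c = let u , v , e , eq = χ-exact c in u , v , e , trans (col-edge e) eq

  open Coloured col col-sym using (Avoids; avoids?; colours)

  rainbow-copy : ∀ v → Unique (Vec.toList v) → Unique (colours path₅ v) → Σ[ φ ∈ Copy (P 5) (K N) ] Rainbow χ φ
  rainbow-copy p p! cs! = φ , rainbow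
    where
    φ : Copy (P 5) (K N)
    φ = record
      { vertex    = Vec.lookup p
      ; injective = λ {i} {j} → lookup-injective p p! i j
      ; edge      = λ {i} {j} e eq → adj-irrefl (P 5) (lookup-injective p p! i j eq) e }

    Spans : Fin 4 → Fin 5 → Fin 5 → Set
    Spans i u v = (u ≡ Fin.inject₁ i × v ≡ suc i) ⊎ (v ≡ Fin.inject₁ i × u ≡ suc i)

    -- Numbering the edges by their lower ends reduces `Rainbow` to distinctness of a vector of four
    -- colours.
    position : ∀ {u v} → Adj (P 5) u v → ∃[ i ] Spans i u v
    position = [ (λ eq → Product.map₂ inj₁ (forward eq)) , (λ eq → Product.map₂ inj₂ (forward eq)) ]′
      where
      forward : ∀ {u v : Fin 5} → suc (toℕ u) ≡ toℕ v → ∃[ i ] u ≡ Fin.inject₁ i × v ≡ suc i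
      forward {u} {suc i} eq = i , Fin.toℕ-injective (trans (ℕ.suc-injective eq) (sym (Fin.toℕ-inject₁ i))) , refl

    step-colour : Fin 4 → Fin k
    step-colour i = col (Vec.lookup p (Fin.inject₁ i)) (Vec.lookup p (suc i))

    cs : Vec (Fin k) 4
    cs = Vec.tabulate step-colour

    colour-at : ∀ {u v} (e : Adj (P 5) u v) → colour χ (edge φ e) ≡ Vec.lookup cs (proj₁ (position e))
    colour-at e with position e
    ... | i , inj₁ (refl , refl) = trans (sym (col-edge (edge φ e))) (sym (Vec.lookup∘tabulate step-colour i))
    ... | i , inj₂ (refl , refl) = trans (sym (col-edge (edge φ e))) (trans (col-sym (Vec.lookup p (suc i)) (Vec.lookup p (Fin.inject₁ i))) (sym (Vec.lookup∘tabulate step-colour i)))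

    same-edge : ∀ {i u v x y} → Spans i u v → Spans i x y → (u ≡ x × v ≡ y) ⊎ (u ≡ y × v ≡ x)
    same-edge (inj₁ (refl , refl)) (inj₁ (refl , refl)) = inj₁ (refl , refl)
    same-edge (inj₁ (refl , refl)) (inj₂ (refl , refl)) = inj₂ (refl , refl)
    same-edge (inj₂ (refl , refl)) (inj₁ (refl , refl)) = inj₂ (refl , refl)
    same-edge (inj₂ (refl , refl)) (inj₂ (refl , refl)) = inj₁ (refl , refl)

    rainbow : Rainbow χ φ
    rainbow {u} {v} e e′ eq = same-edge
      (subst (λ i → Spans i u v)
        (lookup-injective cs cs! _ _ (trans (sym (colour-at e)) (trans eq (colour-at e′)))) (proj₂ (position e)))
      (proj₂ (position e′))

  linked-lookup : ∀ {A : Set} {R : A → A → Set} {xs} → Linked R xs → ∀ i j → suc (toℕ i) ≡ toℕ j →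
    R (lookup xs i) (lookup xs j)
  linked-lookup (r ∷ l) zero    (suc zero)    _  = r
  linked-lookup (r ∷ l) (suc i) (suc j)       eq = linked-lookup l i j (ℕ.suc-injective eq)
  linked-lookup [-]     zero    (suc ())

  unique-lookup : ∀ {A : Set} {xs : List A} → Unique xs → ∀ i j → lookup xs i ≡ lookup xs j → i ≡ j
  unique-lookup (x∉ ∷ u) zero    zero    _  = refl
  unique-lookup (x∉ ∷ u) zero    (suc j) eq = contradiction eq (All.lookup x∉ (∈-lookup j))
  unique-lookup (x∉ ∷ u) (suc i) zero    eq = contradiction (sym eq) (All.lookup x∉ (∈-lookup i))
  unique-lookup (x∉ ∷ u) (suc i) (suc j) eq = cong suc (unique-lookup u i j eq)

  monochromatic-copy : ∀ {n c} → PathOn (λ u v → col u v ≡ c) n → Σ[ φ ∈ Copy (P n) (K N) ] Monochromatic χ φ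
  monochromatic-copy {c = c} (xs , refl , xs! , l) = φ , λ e e′ → trans (at-c e) (sym (at-c e′))
    where
    φ : Copy (P (length xs)) (K N)
    φ = record
      { vertex    = lookup xs
      ; injective = λ {i} {j} → unique-lookup xs! i j
      ; edge      = λ {i} {j} e eq → adj-irrefl (P (length xs)) (unique-lookup xs! i j eq) e }
    at-c : ∀ {u v} (e : Adj (P (length xs)) u v) → colour χ (edge φ e) ≡ c
    at-c e@(inj₁ eq) = trans (sym (col-edge (edge φ e))) (linked-lookup l _ _ eq)
    at-c {u} {v} e@(inj₂ eq) = trans (sym (col-edge (edge φ e))) (trans (col-sym (lookup xs u) (lookup xs v)) (linked-lookup l _ _ eq))

  -- Here m is n - 1. A nearly monochromatic colouring is settled by N ≥ n + 1. Under a dominant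
  -- colour, the first range gives a path in that colour and the second one reduces to two colours.
  rainbow-or-monochromatic : ∀ {m} → 2 + m ≤ N → m ≤ 4 * (k ∸ 2) ⊎ 3 * m ≤ 2 * N →
    (Σ[ φ ∈ Copy (P 5) (K N) ] Rainbow χ φ) ⊎ (Σ[ φ ∈ Copy (P (suc m)) (K N) ] Monochromatic χ φ)
  rainbow-or-monochromatic {m} m<N range with avoids? path₅
  ... | inj₁ (p , p! , cs!) = inj₁ (rainbow-copy p p! cs!)
  ... | inj₂ no-P₅ = inj₂ (monochromatic-copy (proj₂ (path decompose range)))
    where
    open Structure col col-sym N≥7 no-P₅
    open Decomposition col col-sym N≥7 k≥4 exact no-P₅
    open MonochromaticPaths col col-sym N≥7 k≥4 exact no-P₅
    path : NearlyMonochromatic ⊎ ∃ Dominant → m ≤ 4 * (k ∸ 2) ⊎ 3 * m ≤ 2 * N → MonochromaticPath (suc m)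
    path (inj₁ nm)        _            = nearly-monochromatic-path nm m<N
    path (inj₂ (d , dom)) (inj₁ small) = d , dominant-path m (ℕ.<-trans (ℕ.n<1+n m) m<N) small
      where open DominantColour col col-sym exact d (λ {u} {v} {w} → dom {u} {v} {w})
    path (inj₂ (d , dom)) (inj₂ large) = [ (d ,_) , B-path-monochromatic ]′
        (Ramsey.ramsey R B (λ {u} {v} → R-sym {u} {v}) (λ {u} {v} → B-sym {u} {v}) decide (ℕ.≤-trans (s≤s z≤n) N≥7) m large)
      where open DominantColour col col-sym exact d (λ {u} {v} {w} → dom {u} {v} {w})

-- Extremal colourings

colouring : ∀ {N k} (f : Fin N → Fin N → Fin k) → (∀ u v → f u v ≡ f v u) → EdgeColouring (K N) k
colouring f f-sym = record { colour = λ {u} {v} _ → f u v ; colour-undirected = λ {u} {v} _ _ → f-sym u v }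

successive : ∀ {m} (i : Fin m) → Adj (P (suc m)) (Fin.inject₁ i) (suc i)
successive i = inj₁ (cong suc (Fin.toℕ-inject₁ i))

no-injection : ∀ {m n} → n < m → (f : Fin m → ℕ) → (∀ i → f i < n) → (∀ {i j} → f i ≡ f j → i ≡ j) → ⊥
no-injection n<m f f<n f-inj = ℕ.<⇒≱ n<m (Fin.injective⇒≤ {f = λ i → Fin.fromℕ< (f<n i)} λ eq →
  f-inj (trans (sym (Fin.toℕ-fromℕ< _)) (trans (cong toℕ eq) (Fin.toℕ-fromℕ< _))))

-- Two edges of the path could coincide in reverse only if i = j + 1 and i + 1 = j.
rainbow-injective : ∀ {m k F} {χ : EdgeColouring F k} (φ : Copy (P (suc m)) F) → Rainbow χ φ → ∀ i j →
  colour χ (edge φ (successive i)) ≡ colour χ (edge φ (successive j)) → i ≡ j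
rainbow-injective φ rainbow i j eq with rainbow (successive i) (successive j) eq
... | inj₁ (p , _) = Fin.inject₁-injective p
... | inj₂ (p , q) = contradiction
  (trans (sym (cong suc (trans (sym (Fin.toℕ-inject₁ i)) (cong toℕ p)))) (trans (cong toℕ q) (Fin.toℕ-inject₁ j)))
  λ eq′ → ℕ.<-irrefl (sym eq′) (ℕ.m<n⇒m<1+n (ℕ.n<1+n (toℕ j)))

monochromatic-constant : ∀ {m k F} {χ : EdgeColouring F k} (φ : Copy (P (suc m)) F) → Monochromatic χ φ → ∀ i j →
  colour χ (edge φ (successive i)) ≡ colour χ (edge φ (successive j))
monochromatic-constant φ mono i j =
  mono {Fin.inject₁ i} {suc i} {Fin.inject₁ j} {suc j} (successive i) (successive j)

module StarColouring (m k : ℕ) (k≤m : suc k ≤ m) where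

  -- Colour 0 is reserved for edges avoiding the centre `zero`. The vertices 1 to k + 1 realise the
  -- other colours, and surplus vertices repeat colour 1.
  spoke : ℕ → Fin (2 + k)
  spoke v with v <? 2 + k
  ... | yes v<k = Fin.fromℕ< v<k
  ... | no  _   = 1F

  f : Fin (suc m) → Fin (suc m) → Fin (2 + k)
  f zero    v       = spoke (toℕ v)
  f (suc u) zero    = spoke (suc (toℕ u))
  f (suc u) (suc v) = zero

  f-sym : ∀ u v → f u v ≡ f v u
  f-sym zero    zero    = refl
  f-sym zero    (suc v) = refl
  f-sym (suc u) zero    = refl
  f-sym (suc u) (suc v) = refl

  χ : EdgeColouring (K (suc m)) (2 + k)
  χ = colouring f f-sym

  spoke≢0 : ∀ v → spoke (suc v) ≢ zero
  spoke≢0 v eq with suc v <? 2 + k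
  spoke≢0 v () | yes (s≤s _)
  spoke≢0 v () | no  _

  spoke-toℕ : ∀ c → spoke (toℕ c) ≡ c
  spoke-toℕ c with toℕ c <? 2 + k
  ... | yes c<k = Fin.fromℕ<-toℕ c c<k
  ... | no  c≮k = contradiction (Fin.toℕ<n c) c≮k

  at-zero : ∀ {u v} → u ≢ v → u ≡ zero ⊎ v ≡ zero → f u v ≢ zero
  at-zero {zero}  {zero}  u≢v _ = contradiction refl u≢v
  at-zero {zero}  {suc v} _   _ = spoke≢0 (toℕ v)
  at-zero {suc u} {zero}  _   _ = spoke≢0 (toℕ u)
  at-zero {suc u} {suc v} _   (inj₁ ())
  at-zero {suc u} {suc v} _   (inj₂ ())

  off-zero : ∀ {u v} → u ≢ zero → v ≢ zero → f u v ≡ zero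
  off-zero {zero}          u≢0 _   = contradiction refl u≢0
  off-zero {suc u} {zero}  _   v≢0 = contradiction refl v≢0
  off-zero {suc u} {suc v} _   _   = refl

  exact : 2 ≤ m → Exact χ
  exact (s≤s (s≤s _)) zero = 1F , 2F , (λ ()) , refl
  exact _ (suc c) = zero , v , (λ 0≡v → Fin.0≢1+n {i = c} (Fin.toℕ-injective (trans (cong toℕ 0≡v) v≡c))) ,
    trans (cong spoke v≡c) (spoke-toℕ (suc c))
    where
    c<m : toℕ (suc c) < suc m
    c<m = ℕ.≤-trans (Fin.toℕ<n (suc c)) (s≤s k≤m)
    v : Fin (suc m)
    v = Fin.fromℕ< c<m
    v≡c : toℕ v ≡ toℕ (suc c)
    v≡c = Fin.toℕ-fromℕ< c<m

  module _ {l} (φ : Copy (P (suc l)) (K (suc m))) where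

    private
      p = vertex φ

    elsewhere : ∀ {i} → p i ≡ zero → ∀ j → i ≢ j → p j ≢ zero
    elsewhere pi≡0 j i≢j pj≡0 = i≢j (injective φ (trans pi≡0 (sym pj≡0)))

    step≢0 : ∀ i → p (Fin.inject₁ i) ≡ zero ⊎ p (suc i) ≡ zero → f (p (Fin.inject₁ i)) (p (suc i)) ≢ zero
    step≢0 i = at-zero (edge φ (successive i))

  -- The centre lies on at most two of the four edges; two others have colour 0.
  not-rainbow : (φ : Copy (P 5) (K (suc m))) → ¬ Rainbow χ φ
  not-rainbow φ rainbow with vertex φ 1F Fin.≟ zero | vertex φ 2F Fin.≟ zero | vertex φ 3F Fin.≟ zero
  ... | yes p≡0 | _      | _      = case clash of λ ()
    where
    off = elsewhere φ p≡0
    clash = rainbow-injective {m = 4} {χ = χ} φ rainbow 2F 3F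
      (trans (off-zero (off 2F λ ()) (off 3F λ ())) (sym (off-zero (off 3F λ ()) (off 4F λ ()))))
  ... | no _   | yes p≡0 | _      = case clash of λ ()
    where
    off = elsewhere φ p≡0
    clash = rainbow-injective {m = 4} {χ = χ} φ rainbow 0F 3F
      (trans (off-zero (off 0F λ ()) (off 1F λ ())) (sym (off-zero (off 3F λ ()) (off 4F λ ()))))
  ... | no _   | no _   | yes p≡0 = case clash of λ ()
    where
    off = elsewhere φ p≡0
    clash = rainbow-injective {m = 4} {χ = χ} φ rainbow 0F 1F
      (trans (off-zero (off 0F λ ()) (off 1F λ ())) (sym (off-zero (off 1F λ ()) (off 2F λ ()))))
  ... | no p₁ | no p₂ | no p₃ =
    case rainbow-injective {m = 4} {χ = χ} φ rainbow 1F 2F (trans (off-zero p₁ p₂) (sym (off-zero p₂ p₃))) of λ ()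

  -- A path on all m + 1 vertices meets the centre. An edge there is not coloured 0, whereas for m ≥
  -- 3 some other edge avoids the centre.
  not-monochromatic : 3 ≤ m → (φ : Copy (P (suc m)) (K (suc m))) → ¬ Monochromatic χ φ
  not-monochromatic (s≤s (s≤s (s≤s _))) φ mono with Fin.any? (λ i → vertex φ i Fin.≟ zero)
  ... | yes (0F , p≡0) = step≢0 φ 0F (inj₁ p≡0)
    (trans (monochromatic-constant {χ = χ} φ mono 0F 2F) (off-zero (elsewhere φ p≡0 2F λ ()) (elsewhere φ p≡0 3F λ ())))
  ... | yes (1F , p≡0) = step≢0 φ 0F (inj₂ p≡0)
    (trans (monochromatic-constant {χ = χ} φ mono 0F 2F) (off-zero (elsewhere φ p≡0 2F λ ()) (elsewhere φ p≡0 3F λ ())))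
  ... | yes (suc (suc i) , p≡0) = step≢0 φ (suc i) (inj₂ p≡0)
    (trans (monochromatic-constant {χ = χ} φ mono (suc i) 0F) (off-zero (elsewhere φ p≡0 0F λ ()) (elsewhere φ p≡0 1F λ ())))
  ... | no  none = ℕ.1+n≰n (Fin.injective⇒≤ {f = λ i → Fin.punchOut (avoid i)}
      λ {i} {j} eq → injective φ (Fin.punchOut-injective (avoid i) (avoid j) eq))
    where
    avoid : ∀ i → zero ≢ vertex φ i
    avoid i 0≡p = none (i , sym 0≡p)

-- Halving is two-to-one, so a matched pair of vertices has no room for a path on three vertices.
same-half : ∀ a b c → ⌊ a /2⌋ ≡ ⌊ b /2⌋ → ⌊ a /2⌋ ≡ ⌊ c /2⌋ → a ≡ b ⊎ a ≡ c ⊎ b ≡ c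
same-half 0 0 _ _ _ = inj₁ refl
same-half 1 1 _ _ _ = inj₁ refl
same-half 0 1 0 _ _ = inj₂ (inj₁ refl)
same-half 0 1 1 _ _ = inj₂ (inj₂ refl)
same-half 1 0 0 _ _ = inj₂ (inj₂ refl)
same-half 1 0 1 _ _ = inj₂ (inj₁ refl)
same-half (suc (suc a)) (suc (suc b)) (suc (suc c)) p q =
  Sum.map (cong (2 +_)) (Sum.map (cong (2 +_)) (cong (2 +_))) (same-half a b c (ℕ.suc-injective p) (ℕ.suc-injective q))

module BlockColouring (b m k : ℕ) where

  -- Below b, the vertices 2j and 2j + 1 are matched by colour j + 2 for j < k; from b on lies the block.
  -- An edge inside a class takes the colour of the class, any other edge takes colour 0.
  class : ℕ → Fin (2 + k)
  class u with u <? b | ⌊ u /2⌋ <? k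
  ... | yes _ | yes h<k = suc (suc (Fin.fromℕ< h<k))
  ... | yes _ | no  _   = zero
  ... | no  _ | _       = 1F

  class-large : ∀ {u} → b ≤ u → class u ≡ 1F
  class-large {u} b≤u with u <? b | ⌊ u /2⌋ <? k
  ... | yes u<b | _ = contradiction b≤u (ℕ.<⇒≱ u<b)
  ... | no  _   | _ = refl

  class-pair : ∀ {u} c → u < b → ⌊ u /2⌋ ≡ toℕ c → class u ≡ suc (suc c)
  class-pair {u} c u<b eq with u <? b | ⌊ u /2⌋ <? k
  ... | yes _   | yes h<k = cong (λ i → suc (suc i)) (Fin.toℕ-injective (trans (Fin.toℕ-fromℕ< h<k) eq))
  ... | yes _   | no  h≮k = contradiction (subst (_< k) (sym eq) (Fin.toℕ<n c)) h≮k
  ... | no  u≮b | _       = contradiction u<b u≮b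

  class-large⁻ : ∀ u → class u ≡ 1F → b ≤ u
  class-large⁻ u eq with u <? b | ⌊ u /2⌋ <? k
  class-large⁻ u () | yes _ | yes _
  class-large⁻ u () | yes _ | no  _
  ... | no u≮b | _ = ℕ.≮⇒≥ u≮b

  class-pair⁻ : ∀ u c → class u ≡ suc (suc c) → ⌊ u /2⌋ ≡ toℕ c
  class-pair⁻ u c eq with u <? b | ⌊ u /2⌋ <? k
  class-pair⁻ u c refl | yes _ | yes h<k = sym (Fin.toℕ-fromℕ< h<k)

  merge : Fin (2 + k) → Fin (2 + k) → Fin (2 + k)
  merge c d with c Fin.≟ d
  ... | yes _ = c
  ... | no  _ = zero

  merge-diag : ∀ c → merge c c ≡ c
  merge-diag c with c Fin.≟ c
  ... | yes _  = refl
  ... | no c≢c = contradiction refl c≢c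

  merge-view : ∀ c d → merge c d ≡ zero ⊎ (c ≡ d × merge c d ≡ c)
  merge-view c d with c Fin.≟ d
  ... | yes c≡d = inj₂ (c≡d , refl)
  ... | no  _   = inj₁ refl

  merge-≢ : ∀ {c d} → c ≢ d → merge c d ≡ zero
  merge-≢ {c} {d} c≢d = [ id , (λ (c≡d , _) → contradiction c≡d c≢d) ]′ (merge-view c d)

  merge-sym : ∀ c d → merge c d ≡ merge d c
  merge-sym c d with c Fin.≟ d
  ... | yes refl = sym (merge-diag c)
  ... | no  c≢d  = sym (merge-≢ (c≢d ∘ sym))

  f : Fin (b + m) → Fin (b + m) → Fin (2 + k)
  f u v = merge (class (toℕ u)) (class (toℕ v))

  χ : EdgeColouring (K (b + m)) (2 + k)
  χ = colouring f (λ u v → merge-sym (class (toℕ u)) (class (toℕ v)))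

  exact : 1 ≤ b → k + k ≤ b → 2 ≤ m → Exact χ
  exact 1≤b 2k≤b 2≤m = witness
    where
    joined : ∀ {u v} (u<N : u < b + m) (v<N : v < b + m) {c} → u ≢ v → merge (class u) (class v) ≡ c →
      ∃[ x ] ∃[ y ] Σ[ e ∈ x ≢ y ] colour χ {x} {y} e ≡ c
    joined u<N v<N u≢v eq = Fin.fromℕ< u<N , Fin.fromℕ< v<N ,
      (λ x≡y → u≢v (trans (sym (Fin.toℕ-fromℕ< u<N)) (trans (cong toℕ x≡y) (Fin.toℕ-fromℕ< v<N)))) ,
      trans (cong₂ (λ x y → merge (class x) (class y)) (Fin.toℕ-fromℕ< u<N) (Fin.toℕ-fromℕ< v<N)) eq
    b<N : b < b + m
    b<N = ℕ.m<m+n b (ℕ.≤-trans (s≤s z≤n) 2≤m)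
    1+b<N : suc b < b + m
    1+b<N = subst (_≤ b + m) (ℕ.+-comm b 2) (ℕ.+-monoʳ-≤ b 2≤m)
    witness : Exact χ
    witness zero = joined (ℕ.<-trans 1≤b b<N) b<N (ℕ.<⇒≢ 1≤b)
      (merge-≢ (λ eq → ℕ.<⇒≱ 1≤b (class-large⁻ 0 (trans eq (class-large ℕ.≤-refl)))))
    witness 1F = joined b<N 1+b<N (ℕ.<⇒≢ (ℕ.n<1+n b))
      (trans (cong₂ merge (class-large ℕ.≤-refl) (class-large (ℕ.n≤1+n b))) (merge-diag 1F))
    witness (suc (suc c)) = joined (ℕ.<-trans j<b b<N) (ℕ.<-trans 1+j<b b<N) (ℕ.<⇒≢ (ℕ.n<1+n j))
      (trans (cong₂ merge (class-pair c j<b (sym (ℕ.n≡⌊n+n/2⌋ (toℕ c)))) (class-pair c 1+j<b (sym (ℕ.n≡⌈n+n/2⌉ (toℕ c)))))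
        (merge-diag (suc (suc c))))
      where
      j = toℕ c + toℕ c
      1+j<b : suc j < b
      1+j<b = ℕ.≤-trans (ℕ.≤-reflexive (cong suc (sym (ℕ.+-suc (toℕ c) (toℕ c))))) (ℕ.≤-trans (ℕ.+-mono-≤ (Fin.toℕ<n c) (Fin.toℕ<n c)) 2k≤b)
      j<b : j < b
      j<b = ℕ.<-trans (ℕ.n<1+n j) 1+j<b

  -- Of two consecutive edges, one has colour 0 or both lie inside one class. Cutting the path into
  -- two such pairs gives a repetition or two edges of colour 0.
  not-rainbow : (φ : Copy (P 5) (K (b + m))) → ¬ Rainbow χ φ
  not-rainbow φ rainbow with zero-edge 0F 1F 2F | zero-edge 2F 3F 4F
    where
    zero-edge : ∀ i j l → let p = vertex φ in f (p i) (p j) ≡ zero ⊎ f (p j) (p l) ≡ zero ⊎ f (p i) (p j) ≡ f (p j) (p l)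
    zero-edge i j l with merge-view (class (toℕ (vertex φ i))) (class (toℕ (vertex φ j)))
                       | merge-view (class (toℕ (vertex φ j))) (class (toℕ (vertex φ l)))
    ... | inj₁ z           | _                = inj₁ z
    ... | inj₂ _           | inj₁ z           = inj₂ (inj₁ z)
    ... | inj₂ (ij , f≡i)  | inj₂ (_ , f≡j)   = inj₂ (inj₂ (trans f≡i (trans ij (sym f≡j))))
  ... | inj₂ (inj₂ eq) | _              = case rainbow-injective {m = 4} {χ = χ} φ rainbow 0F 1F eq of λ ()
  ... | inj₁ _         | inj₂ (inj₂ eq) = case rainbow-injective {m = 4} {χ = χ} φ rainbow 2F 3F eq of λ ()
  ... | inj₂ (inj₁ _)  | inj₂ (inj₂ eq) = case rainbow-injective {m = 4} {χ = χ} φ rainbow 2F 3F eq of λ ()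
  ... | inj₁ z         | inj₁ z′        = case rainbow-injective {m = 4} {χ = χ} φ rainbow 0F 2F (trans z (sym z′)) of λ ()
  ... | inj₁ z         | inj₂ (inj₁ z′) = case rainbow-injective {m = 4} {χ = χ} φ rainbow 0F 3F (trans z (sym z′)) of λ ()
  ... | inj₂ (inj₁ z)  | inj₁ z′        = case rainbow-injective {m = 4} {χ = χ} φ rainbow 1F 2F (trans z (sym z′)) of λ ()
  ... | inj₂ (inj₁ z)  | inj₂ (inj₁ z′) = case rainbow-injective {m = 4} {χ = χ} φ rainbow 1F 3F (trans z (sym z′)) of λ ()

  module _ (φ : Copy (P (suc m)) (K (b + m))) where

    private
      p : Fin (suc m) → ℕ
      p i = toℕ (vertex φ i)

    p-injective : ∀ {i j} → p i ≡ p j → i ≡ j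
    p-injective eq = injective φ (Fin.toℕ-injective eq)

    -- No edge inside the block has colour 0, so one of the positions 2j and 2j + 1 holds a vertex
    -- below `b`. There are more such pairs than vertices below `b`.
    no-zero-path : b < ⌊ suc m /2⌋ → (∀ i → merge (class (p (Fin.inject₁ i))) (class (p (suc i))) ≡ zero) → ⊥
    no-zero-path b<h zeros = no-injection b<h (p ∘ pick) (λ j → proj₂ (proj₂ (picked j)))
      λ {i} {j} eq → Fin.toℕ-injective (trans (sym (half i)) (trans (cong (⌊_/2⌋ ∘ toℕ) (p-injective eq)) (half j)))
      where
      double< : ∀ (j : Fin ⌊ suc m /2⌋) → toℕ j + toℕ j < m
      double< j = s≤s⁻¹ (begin
        suc (suc (toℕ j + toℕ j))         ≡⟨ cong suc (sym (ℕ.+-suc (toℕ j) (toℕ j))) ⟩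
        suc (toℕ j) + suc (toℕ j)         ≤⟨ ℕ.+-mono-≤ (Fin.toℕ<n j) (ℕ.≤-trans (Fin.toℕ<n j) (ℕ.⌊n/2⌋≤⌈n/2⌉ (suc m))) ⟩
        ⌊ suc m /2⌋ + ⌈ suc m /2⌉         ≡⟨ ℕ.⌊n/2⌋+⌈n/2⌉≡n (suc m) ⟩
        suc m                             ∎)
        where open ℕ.≤-Reasoning
      picked : ∀ j → ∃[ i ] ⌊ toℕ i /2⌋ ≡ toℕ j × p i < b
      picked j with class (p (Fin.inject₁ (Fin.fromℕ< (double< j)))) Fin.≟ 1F
      ... | yes c≡1 = suc e , trans (cong (λ n → ⌊ suc n /2⌋) e≡) (sym (ℕ.n≡⌈n+n/2⌉ (toℕ j))) , small
        where
        e = Fin.fromℕ< (double< j)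
        e≡ : toℕ e ≡ toℕ j + toℕ j
        e≡ = Fin.toℕ-fromℕ< (double< j)
        small : p (suc e) < b
        small = ℕ.≰⇒> λ b≤ → case trans (sym (trans (cong₂ merge c≡1 (class-large b≤)) (merge-diag 1F))) (zeros e) of λ ()
      ... | no  c≢1 = Fin.inject₁ e , trans (cong ⌊_/2⌋ (trans (Fin.toℕ-inject₁ e) e≡)) (sym (ℕ.n≡⌊n+n/2⌋ (toℕ j))) , ℕ.≰⇒> (c≢1 ∘ class-large)
        where
        e = Fin.fromℕ< (double< j)
        e≡ : toℕ e ≡ toℕ j + toℕ j
        e≡ = Fin.toℕ-fromℕ< (double< j)
      pick : Fin ⌊ suc m /2⌋ → Fin (suc m)
      pick j = proj₁ (picked j)
      half : ∀ j → ⌊ toℕ (pick j) /2⌋ ≡ toℕ j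
      half j = proj₁ (proj₂ (picked j))

    -- The block has m vertices, one too few for the path, and every other such class has at most
    -- two.
    no-class-path : 2 ≤ m → ∀ c → (∀ i → class (p i) ≡ suc c) → ⊥
    no-class-path _ zero all-c = no-injection (ℕ.n<1+n m) (λ i → p i ∸ b)
      (λ i → ℕ.+-cancelˡ-< b _ _ (subst (_< b + m) (sym (ℕ.m+[n∸m]≡n (large i))) (Fin.toℕ<n (vertex φ i))))
      λ {i} {j} eq → p-injective (ℕ.∸-cancelʳ-≡ (large i) (large j) eq)
      where
      large : ∀ i → b ≤ p i
      large i = class-large⁻ (p i) (all-c i)
    no-class-path (s≤s (s≤s _)) (suc c) all-c
      with same-half (p 0F) (p 1F) (p 2F) (trans (halves 0F) (sym (halves 1F))) (trans (halves 0F) (sym (halves 2F)))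
      where
      halves : ∀ i → ⌊ p i /2⌋ ≡ toℕ c
      halves i = class-pair⁻ (p i) c (all-c i)
    ... | inj₁ eq        = case p-injective eq of λ ()
    ... | inj₂ (inj₁ eq) = case p-injective eq of λ ()
    ... | inj₂ (inj₂ eq) = case p-injective eq of λ ()

    not-monochromatic : 2 ≤ m → b < ⌊ suc m /2⌋ → ¬ Monochromatic χ φ
    not-monochromatic 2≤m@(s≤s _) b<h mono = by-colour (merge (class (p 0F)) (class (p 1F))) (λ i → monochromatic-constant {χ = χ} φ mono i 0F)
      where
      by-colour : ∀ c → (∀ i → merge (class (p (Fin.inject₁ i))) (class (p (suc i))) ≡ c) → ⊥
      by-colour zero    steps = no-zero-path b<h steps
      by-colour (suc c) steps = no-class-path 2≤m c classes
        where
        step-class : ∀ i → class (p (Fin.inject₁ i)) ≡ suc c × class (p (suc i)) ≡ suc c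
        step-class i with merge-view (class (p (Fin.inject₁ i))) (class (p (suc i)))
        ... | inj₁ z         = case trans (sym z) (steps i) of λ ()
        ... | inj₂ (eq , f≡) = trans (sym f≡) (steps i) , trans (sym eq) (trans (sym f≡) (steps i))
        classes : ∀ i → class (p i) ≡ suc c
        classes zero    = proj₁ (step-class 0F)
        classes (suc i) = proj₂ (step-class i)

-- The numerical bounds and the two ranges of n.

half-of-triple : ∀ m → ⌈ 3 * suc m ∸ 3 /2⌉ ≡ m + ⌈ m /2⌉
half-of-triple m = trans (cong (λ l → ⌈ l ∸ 3 /2⌉) (ℕ.*-suc 3 m)) (trans (pull-out m (m + 0)) (cong (λ l → m + ⌈ l /2⌉) (ℕ.+-identityʳ m)))
  where
  pull-out : ∀ a b → ⌈ a + (a + b) /2⌉ ≡ a + ⌈ b /2⌉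
  pull-out zero    b = refl
  pull-out (suc a) b = trans (cong (λ l → ⌈ suc l /2⌉) (ℕ.+-suc a (a + b))) (cong suc (pull-out a b))

star-lower-bound : ∀ m k → suc k ≤ m → 3 ≤ m → ∀ M → GallaiRamseyBound (2 + k) (P 5) (P (suc m)) M → suc m < M
star-lower-bound m k k≤m 3≤m M bound = ℕ.≰⇒> λ M≤n →
  [ (λ (φ , rainbow) → not-rainbow φ rainbow) , (λ (φ , mono) → not-monochromatic 3≤m φ mono) ]′
    (bound (suc m) M≤n χ (exact (ℕ.≤-trans (ℕ.n≤1+n 2) 3≤m)))
  where open StarColouring m k k≤m

block-lower-bound : ∀ b m k → 1 ≤ b → k + k ≤ b → 2 ≤ m → b < ⌊ suc m /2⌋ →
  ∀ M → GallaiRamseyBound (2 + k) (P 5) (P (suc m)) M → b + m < M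
block-lower-bound b m k 1≤b 2k≤b 2≤m b<h M bound = ℕ.≰⇒> λ M≤N →
  [ (λ (φ , rainbow) → not-rainbow φ rainbow) , (λ (φ , mono) → not-monochromatic φ 2≤m b<h mono) ]′
    (bound (b + m) M≤N χ (exact 1≤b 2k≤b 2≤m))
  where open BlockColouring b m k

theorem1p7 : (n k : ℕ) → n ≥ k → k ≥ 4 →
    (2 * (k ∸ 1) ≤ n → n ≤ 4 * (k ∸ 2) + 1 →
    IsGallaiRamseyNumber k (P 5) (P n) (n + 1))
    × (n > 4 * (k ∸ 2) + 1 →
    IsGallaiRamseyNumber k (P 5) (P n) ⌈ 3 * n ∸ 3 /2⌉)
theorem1p7 (suc m) k@(suc (suc k′)) (s≤s k′<m) k≥4@(s≤s (s≤s 2≤k′)) = short , long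
  where
  open ℕ.≤-Reasoning

  3≤m : 3 ≤ m
  3≤m = ℕ.≤-trans (s≤s 2≤k′) k′<m

  short : 2 * suc k′ ≤ suc m → suc m ≤ 4 * k′ + 1 → IsGallaiRamseyNumber k (P 5) (P (suc m)) (suc m + 1)
  short 2k≤n n≤4k = upper , λ M bound → subst (_≤ M) (ℕ.+-comm 1 (suc m)) (star-lower-bound m k′ k′<m 3≤m M bound)
    where
    upper : GallaiRamseyBound k (P 5) (P (suc m)) (suc m + 1)
    upper N n<N χ χ-exact = UpperBound.rainbow-or-monochromatic 7≤N k≥4 χ χ-exact n<N′
      (inj₁ (s≤s⁻¹ (subst (suc m ≤_) (ℕ.+-comm (4 * k′) 1) n≤4k)))
      where
      n<N′ : 2 + m ≤ N
      n<N′ = subst (_≤ N) (ℕ.+-comm (suc m) 1) n<N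
      7≤N : 7 ≤ N
      -- From k ≥ 4 and n ≥ 2(k - 1) follows n ≥ 6, and N ≥ n + 1.
      7≤N = ℕ.≤-trans (s≤s (ℕ.≤-trans (ℕ.*-monoʳ-≤ 2 (s≤s 2≤k′)) 2k≤n)) n<N′

  long : suc m > 4 * k′ + 1 → IsGallaiRamseyNumber k (P 5) (P (suc m)) ⌈ 3 * suc m ∸ 3 /2⌉
  long n>4k = subst (IsGallaiRamseyNumber k (P 5) (P (suc m))) (sym (half-of-triple m)) (upper , lower)
    where
    4k<m : suc ((k′ + k′) + (k′ + k′)) ≤ m
    4k<m = begin
      suc ((k′ + k′) + (k′ + k′)) ≡⟨ cong suc (trans (ℕ.+-assoc k′ k′ (k′ + k′)) (cong (λ l → k′ + (k′ + (k′ + l))) (sym (ℕ.+-identityʳ k′)))) ⟩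
      suc (4 * k′)                ≡⟨ ℕ.+-comm 1 (4 * k′) ⟩
      4 * k′ + 1                  ≤⟨ s≤s⁻¹ n>4k ⟩
      m                           ∎
    4≤2k : 4 ≤ k′ + k′
    4≤2k = ℕ.+-mono-≤ 2≤k′ 2≤k′
    5≤m : 5 ≤ m
    5≤m = ℕ.≤-trans (s≤s (ℕ.≤-trans 4≤2k (ℕ.m≤m+n (k′ + k′) (k′ + k′)))) 4k<m
    -- Halving 4(k - 2) < m shows that the vertices beside the block can carry a matching of k - 2
    -- edges.
    2k<h : k′ + k′ < ⌈ m /2⌉
    2k<h = ℕ.≤-trans (ℕ.≤-reflexive (cong suc (ℕ.n≡⌊n+n/2⌋ (k′ + k′)))) (ℕ.⌈n/2⌉-mono 4k<m)
    h = ⌈ m /2⌉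
    -- As n = m + 1, `h` is ⌊n/2⌋, the number of disjoint pairs of positions on the path; `b` must
    -- stay below it.
    b = h ∸ 1
    1+b≡h : suc b ≡ h
    1+b≡h = ℕ.m+[n∸m]≡n (ℕ.≤-trans (s≤s z≤n) 2k<h)
    2k≤b : k′ + k′ ≤ b
    2k≤b = s≤s⁻¹ (subst (k′ + k′ <_) (sym 1+b≡h) 2k<h)
    upper : GallaiRamseyBound k (P 5) (P (suc m)) (m + h)
    upper N m+h≤N χ χ-exact = UpperBound.rainbow-or-monochromatic 7≤N k≥4 χ χ-exact 2+m≤N (inj₂ 3m≤2N)
      where
      2≤h : 2 ≤ h
      2≤h = ℕ.≤-trans (ℕ.m≤n+m 2 3) (ℕ.≤-trans (s≤s 4≤2k) 2k<h)
      2+m≤N : 2 + m ≤ N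
      2+m≤N = ℕ.≤-trans (ℕ.≤-reflexive (ℕ.+-comm 2 m)) (ℕ.≤-trans (ℕ.+-monoʳ-≤ m 2≤h) m+h≤N)
      7≤N : 7 ≤ N
      7≤N = ℕ.≤-trans (ℕ.+-monoʳ-≤ 2 5≤m) 2+m≤N
      3m≤2N : 3 * m ≤ 2 * N
      3m≤2N = begin
        m + 2 * m         ≡⟨ ℕ.+-comm m (2 * m) ⟩
        2 * m + m         ≡⟨ cong (2 * m +_) (sym (ℕ.⌊n/2⌋+⌈n/2⌉≡n m)) ⟩
        2 * m + (⌊ m /2⌋ + h) ≤⟨ ℕ.+-monoʳ-≤ (2 * m) (ℕ.+-monoˡ-≤ h (ℕ.⌊n/2⌋≤⌈n/2⌉ m)) ⟩
        2 * m + (h + h)   ≡⟨ cong (λ l → 2 * m + (h + l)) (sym (ℕ.+-identityʳ h)) ⟩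
        2 * m + 2 * h     ≡⟨ sym (ℕ.*-distribˡ-+ 2 m h) ⟩
        2 * (m + h)       ≤⟨ ℕ.*-monoʳ-≤ 2 m+h≤N ⟩
        2 * N             ∎
    lower : ∀ M → GallaiRamseyBound k (P 5) (P (suc m)) M → m + h ≤ M
    lower M bound = subst (_≤ M) (trans (cong (_+ m) 1+b≡h) (ℕ.+-comm h m))
      (block-lower-bound b m k′ (ℕ.≤-trans (s≤s z≤n) (ℕ.≤-trans 4≤2k 2k≤b)) 2k≤b (ℕ.≤-trans (ℕ.n≤1+n 2) 3≤m)
        (ℕ.≤-reflexive 1+b≡h) M bound)
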